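{- Each of the following classes of matroids is closed under two-sums (i.e. if $\mathcal{L}$ and $\mathcal{M}$ belong to the class and the two-sum $\mathcal{L}\oplus_g\mathcal{M}$ is defined, then $\mathcal{L}\oplus_g\mathcal{M}$ belongs to the class): (a) $\mathbf{B}$-Rayleigh matroids; (b) $\mathbf{I}$-Rayleigh matroids; (c) $\mathbf{S}$-Rayleigh matroids; (d) Potts-Rayleigh matroids.
   Context: For a finite set $E$ and a multiaffine polynomial $Z$ in indeterminates $\mathbf{y}=\{y_e:e\in E\}$ with nonnegative coefficients, not identically zero, let $\Delta Z\{e,f\}=Z_eZ_f-Z_{ef}Z$ where subscripts denote partial derivatives; $Z$ is Rayleigh if $\Delta Z\{e,f\}(\mathbf{y})\ge0$ for all distinct $e,f\in E$ and all $\mathbf{y}$ with all $y_c>0$. For a family $\mathcal{Q}$ of subsets of $E$ let $Z(\mathcal{Q};\mathbf{y})=\sum_{S\in\mathcal{Q}}\prod_{e\in S}y_e$. For a matroid $\mathcal{M}$ on $E$, let $\mathbf{B}\mathcal{M},\mathbf{I}\mathcal{M},\mathbf{S}\mathcal{M}$ be its sets of bases, independent sets and spanning sets; $\mathcal{M}$ is $\mathbf{B}$-Rayleigh (resp. $\mathbf{I}$-, $\mathbf{S}$-Rayleigh) if $Z(\mathbf{B}\mathcal{M};\mathbf{y})$ (resp. $Z(\mathbf{I}\mathcal{M};\mathbf{y})$, $Z(\mathbf{S}\mathcal{M};\mathbf{y})$) is Rayleigh. The Potts model partition function is $Z(\mathcal{M},q;\mathbf{y})=\sum_{S\subseteq E}q^{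 -\mathrm{rank}_{\mathcal{M}}(S)}\mathbf{y}^S$ for real $q>0$; $\mathcal{M}$ is Potts-Rayleigh if there is $q_*>0$ such that $Z(\mathcal{M},q;\mathbf{y})$ is Rayleigh for all $0<q\le q_*$. Two-sum: let $\mathcal{L},\mathcal{M}$ be matroids with $E(\mathcal{L})\cap E(\mathcal{M})=\{g\}$, $g$ neither a loop nor a coloop in $\mathcal{L}$ or in $\mathcal{M}$. Then $\mathcal{N}=\mathcal{L}\oplus_g\mathcal{M}$ is the matroid on $E(\mathcal{L})\cup E(\mathcal{M})\setminus\{g\}$ with rank function $\mathrm{rank}_{\mathcal{N}}(S)=\mathrm{rank}_{\mathcal{L}}(S\cap E(\mathcal{L}))+\mathrm{rank}_{\mathcal{M}}(S\cap E(\mathcal{M}))-\nu(S)$, where $\nu(S)=1$ if $g$ lies in the closure (in $\mathcal{L}$) of $S\cap E(\mathcal{L})$ and in the closure (in $\mathcal{M}$) of $S\cap E(\mathcal{M})$, and $\nu(S)=0$ otherwise. -}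

module Defs where

open import Level using (Level; _⊔_; 0ℓ) renaming (suc to lsuc)
open import Data.Bool.Base using (if_then_else_)
open import Data.Nat.Base as ℕ using (ℕ; zero; suc; z≤n; s≤s)
import Data.Nat.Properties as ℕₚ
open import Data.Nat.Tactic.RingSolver using (solve-∀)
open import Data.Fin.Base using (Fin; zero; suc)
open import Data.Fin.Subset
  using (Subset; inside; outside; _∈_; _∉_; _⊆_; _∪_; _∩_; ⁅_⁆; ∣_∣)
  renaming (_-_ to _∖_)
open import Data.Fin.Subset.Properties
open import Data.Vec.Base using ([]; _∷_; here; there)
open import Data.Product.Base using (∃-syntax; _×_; _,_; proj₁; proj₂)
open import Data.Sum.Base using (_⊎_; inj₁; inj₂; [_,_]′)
open import Function.Base using (_∘_)
open import Function.Bundles using (_⇔_)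
open import Relation.Nullary using (¬_; Dec; yes; no; does; contradiction)
open import Relation.Nullary.Decidable using (_×-dec_; dec-true; dec-false)
open import Relation.Unary using (Pred; Decidable)
open import Relation.Binary.Core using (Rel)
open import Relation.Binary.Structures using (IsStrictPartialOrder)
open import Relation.Binary.PropositionalEquality
  using (_≡_; _≢_; refl; sym; trans; cong; cong₂; subst; subst₂)
open import Algebra.Apartness.Bundles using (HeytingField)
open import Algebra.Bundles using (CommutativeRing; Semiring)
import Algebra.Definitions.RawSemiring as RawSemiringDefs

private
  variable
    n : ℕ

-- The real numbers, axiomatised as an Archimedean, Cauchy complete ordered
-- field; classically these axioms determine ℝ up to isomorphism.  They are
-- formulated constructively: the order is cotransitive (through the
-- apartness relation) instead of decidable, and only elements apart from 0
-- are invertible.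

record RealField c ℓ₁ ℓ₂ : Set (lsuc (c ⊔ ℓ₁ ⊔ ℓ₂)) where
  field
    heytingField : HeytingField c ℓ₁ ℓ₂

  open HeytingField heytingField public
    using ( Carrier; _≈_; _#_; _+_; _*_; -_; _-_; 0#; 1#
          ; heytingCommutativeRing; apartnessRelation
          ; #⇒invertible; invertible⇒#; tight; #-cotrans)

  commutativeRing : CommutativeRing c ℓ₁
  commutativeRing = record
    { isCommutativeRing = HeytingField.isCommutativeRing heytingField }

  open RawSemiringDefs (Semiring.rawSemiring (CommutativeRing.semiring commutativeRing)) public
    using (_^_) renaming (_×_ to _·_)

  infix 4 _<_ _≤_

  field
    _<_                  : Rel Carrier ℓ₂
    isStrictPartialOrder : IsStrictPartialOrder _≈_ _<_
    #⇔<⊎>                : ∀ x y → x # y ⇔ (x < y ⊎ y < x)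
    +-monoˡ-<            : ∀ z {x y} → x < y → (x + z) < (y + z)
    *-pos                : ∀ {x y} → 0# < x → 0# < y → 0# < (x * y)

  _≤_ : Rel Carrier ℓ₂
  x ≤ y = ¬ (y < x)

  -- Quantifying over both k and l makes the absolute value unnecessary.
  IsCauchy : (ℕ → Carrier) → Set (c ⊔ ℓ₂)
  IsCauchy x = ∀ ε → 0# < ε →
    ∃[ N ] (∀ k l → N ℕ.≤ k → N ℕ.≤ l → x k < (x l + ε))

  _ConvergesTo_ : (ℕ → Carrier) → Carrier → Set (c ⊔ ℓ₂)
  x ConvergesTo a = ∀ ε → 0# < ε →
    ∃[ N ] (∀ k → N ℕ.≤ k → x k < (a + ε) × a < (x k + ε))

  field
    archimedean : ∀ x → ∃[ k ] (x < k · 1#)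
    complete    : ∀ x → IsCauchy x → ∃[ a ] (x ConvergesTo a)

  infix 8 _⁻¹[_]
  _⁻¹[_] : ∀ x → 0# < x → Carrier
  x ⁻¹[ 0<x ] = proj₁ (#⇒invertible {x} {0#} (from (inj₂ 0<x)))
    where open Function.Bundles.Equivalence (#⇔<⊎> x 0#) using (from)

-- The ground set is a subset of an ambient finite set Fin n, so
-- that the ground sets of two matroids can overlap.  Values of the rank
-- function on sets not contained in the ground set carry no information.

record Matroid (n : ℕ) : Set where
  field
    E               : Subset n
    rank            : Subset n → ℕ
    rank-≤-size     : ∀ {S} → S ⊆ E → rank S ℕ.≤ ∣ S ∣
    rank-mono       : ∀ {S T} → S ⊆ T → T ⊆ E → rank S ℕ.≤ rank T
    rank-submodular : ∀ {S T} → S ⊆ E → T ⊆ E →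
                      rank (S ∪ T) ℕ.+ rank (S ∩ T) ℕ.≤ rank S ℕ.+ rank T

  Independent : Pred (Subset n) 0ℓ
  Independent S = S ⊆ E × rank S ≡ ∣ S ∣

  Spanning : Pred (Subset n) 0ℓ
  Spanning S = S ⊆ E × rank S ≡ rank E

  Basis : Pred (Subset n) 0ℓ
  Basis S = Independent S × Spanning S

  independent? : Decidable Independent
  independent? S = (S ⊆? E) ×-dec (rank S ℕₚ.≟ ∣ S ∣)

  spanning? : Decidable Spanning
  spanning? S = (S ⊆? E) ×-dec (rank S ℕₚ.≟ rank E)

  basis? : Decidable Basis
  basis? S = independent? S ×-dec spanning? S

  infix 4 _∈cl_ _∈cl?_

  _∈cl_ : Fin n → Subset n → Set
  e ∈cl S = e ∈ E × rank (S ∪ ⁅ e ⁆) ≡ rank S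

  _∈cl?_ : ∀ e S → Dec (e ∈cl S)
  e ∈cl? S = (e ∈? E) ×-dec (rank (S ∪ ⁅ e ⁆) ℕₚ.≟ rank S)

  Loop : Fin n → Set
  Loop e = e ∈ E × rank ⁅ e ⁆ ≡ 0

  Coloop : Fin n → Set
  Coloop e = e ∈ E × (∀ B → Basis B → e ∈ B)

module _ (L M : Matroid n) (g : Fin n) where

  private
    module L = Matroid L
    module M = Matroid M

  record TwoSummable : Set where
    field
      E∩E≡g       : L.E ∩ M.E ≡ ⁅ g ⁆
      ¬loopˡ      : ¬ L.Loop g
      ¬loopʳ      : ¬ M.Loop g
      ¬coloopˡ    : ¬ L.Coloop g
      ¬coloopʳ    : ¬ M.Coloop g

  ν? : ∀ S → Dec (g L.∈cl S ∩ L.E × g M.∈cl S ∩ M.E)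
  ν? S = (g L.∈cl? S ∩ L.E) ×-dec (g M.∈cl? S ∩ M.E)

  ν : Subset n → ℕ
  ν S = if does (ν? S) then 1 else 0

  twoSumE : Subset n
  twoSumE = (L.E ∪ M.E) ∖ g

  -- The subtraction is never truncated: see ν≤ below.
  twoSumRank : Subset n → ℕ
  twoSumRank S = (L.rank (S ∩ L.E) ℕ.+ M.rank (S ∩ M.E)) ℕ.∸ ν S

module Closure (N : Matroid n) {g : Fin n} (g∈E : g ∈ Matroid.E N) where
  open Matroid N
  open import Data.Nat.Base using (_≤_; _<_; _+_)

  ∪-⊆ : ∀ {S T U : Subset n} → S ⊆ U → T ⊆ U → S ∪ T ⊆ U
  ∪-⊆ {S} {T} p q = [ p , q ]′ ∘ x∈p∪q⁻ S T

  g⊆E : ⁅ g ⁆ ⊆ E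
  g⊆E x∈g = subst (_∈ E) (sym (x∈⁅y⁆⇒x≡y g x∈g)) g∈E

  ∪g⊆E : ∀ {S} → S ⊆ E → S ∪ ⁅ g ⁆ ⊆ E
  ∪g⊆E S⊆E = ∪-⊆ S⊆E g⊆E

  ∪g-mono : ∀ {S T : Subset n} → S ⊆ T → S ∪ ⁅ g ⁆ ⊆ T ∪ ⁅ g ⁆
  ∪g-mono {S} {T} p = ∪-⊆ (p⊆p∪q ⁅ g ⁆ ∘ p) (q⊆p∪q T ⁅ g ⁆)

  ∉cl⇒< : ∀ {S} → S ⊆ E → ¬ g ∈cl S → rank S < rank (S ∪ ⁅ g ⁆)
  ∉cl⇒< {S} S⊆E g∉ = ℕₚ.≤∧≢⇒< (rank-mono (p⊆p∪q ⁅ g ⁆) (∪g⊆E S⊆E))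
                        λ eq → g∉ (g∈E , sym eq)

  cl-strict : ∀ {S T} → S ⊆ T → T ⊆ E → ¬ g ∈cl S → g ∈cl T → rank S < rank T
  cl-strict S⊆T T⊆E g∉ (_ , eq) = ℕₚ.<-≤-trans (∉cl⇒< (T⊆E ∘ S⊆T) g∉)
    (ℕₚ.≤-trans (rank-mono (∪g-mono S⊆T) (∪g⊆E T⊆E)) (ℕₚ.≤-reflexive eq))

  cl-submodular : ∀ {S T} → S ⊆ E → T ⊆ E → g ∈cl S → g ∈cl T →
    rank (S ∪ T) + rank ((S ∩ T) ∪ ⁅ g ⁆) ≤ rank S + rank T
  cl-submodular {S} {T} S⊆E T⊆E (_ , p) (_ , q) = begin
    rank (S ∪ T) + rank ((S ∩ T) ∪ ⁅ g ⁆)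
      ≤⟨ ℕₚ.+-mono-≤ (rank-mono S∪T⊆ (∪-⊆ (∪g⊆E S⊆E) (∪g⊆E T⊆E)))
           (ℕₚ.≤-reflexive (cong rank (∪-distribʳ-∩ ⁅ g ⁆ S T))) ⟩
    rank ((S ∪ ⁅ g ⁆) ∪ (T ∪ ⁅ g ⁆)) + rank ((S ∪ ⁅ g ⁆) ∩ (T ∪ ⁅ g ⁆))
      ≤⟨ rank-submodular (∪g⊆E S⊆E) (∪g⊆E T⊆E) ⟩
    rank (S ∪ ⁅ g ⁆) + rank (T ∪ ⁅ g ⁆)
      ≡⟨ cong₂ _+_ p q ⟩
    rank S + rank T ∎
    where
    open ℕₚ.≤-Reasoning
    S∪T⊆ : S ∪ T ⊆ (S ∪ ⁅ g ⁆) ∪ (T ∪ ⁅ g ⁆)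
    S∪T⊆ = ∪-⊆ (p⊆p∪q (T ∪ ⁅ g ⁆) ∘ p⊆p∪q ⁅ g ⁆)
                (q⊆p∪q (S ∪ ⁅ g ⁆) (T ∪ ⁅ g ⁆) ∘ p⊆p∪q ⁅ g ⁆)

  cl-submodular-strict : ∀ {S T} → S ⊆ E → T ⊆ E → g ∈cl S → g ∈cl T →
    ¬ g ∈cl (S ∩ T) → rank (S ∪ T) + rank (S ∩ T) < rank S + rank T
  cl-submodular-strict {S} {T} S⊆E T⊆E p q g∉ = ℕₚ.<-≤-trans
    (ℕₚ.+-monoʳ-< (rank (S ∪ T)) (∉cl⇒< (S⊆E ∘ p∩q⊆p S T) g∉))
    (cl-submodular S⊆E T⊆E p q)

  cl-mono : ∀ {S T} → S ⊆ T → T ⊆ E → g ∈cl S → g ∈cl T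
  cl-mono {S} {T} S⊆T T⊆E (_ , p) = g∈E , ℕₚ.≤-antisym
    (ℕₚ.+-cancelʳ-≤ (rank S) _ _ (begin
      rank (T ∪ ⁅ g ⁆) + rank S
        ≤⟨ ℕₚ.+-mono-≤
             (rank-mono (∪-⊆ (p⊆p∪q _) (q⊆p∪q T _ ∘ q⊆p∪q S _)) U⊆E)
             (rank-mono S⊆∩ (T⊆E ∘ p∩q⊆p T (S ∪ ⁅ g ⁆))) ⟩
      rank (T ∪ (S ∪ ⁅ g ⁆)) + rank (T ∩ (S ∪ ⁅ g ⁆))
        ≤⟨ rank-submodular T⊆E (∪g⊆E (T⊆E ∘ S⊆T)) ⟩
      rank T + rank (S ∪ ⁅ g ⁆)
        ≡⟨ cong (rank T +_) p ⟩
      rank T + rank S ∎))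
    (rank-mono (p⊆p∪q _) (∪g⊆E T⊆E))
    where
    open ℕₚ.≤-Reasoning
    U⊆E : T ∪ (S ∪ ⁅ g ⁆) ⊆ E
    U⊆E = ∪-⊆ T⊆E (∪g⊆E (T⊆E ∘ S⊆T))
    S⊆∩ : S ⊆ T ∩ (S ∪ ⁅ g ⁆)
    S⊆∩ x∈S = x∈p∩q⁺ (S⊆T x∈S , p⊆p∪q _ x∈S)

  cl⇒rank-pos : ¬ Loop g → ∀ {S} → S ⊆ E → g ∈cl S → 1 ≤ rank S
  cl⇒rank-pos ¬loop {S} S⊆E (_ , eq) = subst (1 ≤_) eq (ℕₚ.≤-trans
    (ℕₚ.n≢0⇒n>0 (¬loop ∘ (g∈E ,_))) (rank-mono (q⊆p∪q S ⁅ g ⁆) (∪g⊆E S⊆E)))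

∩-mono : ∀ {S T : Subset n} U → S ⊆ T → S ∩ U ⊆ T ∩ U
∩-mono {S = S} U S⊆T x∈ with x∈p∩q⁻ S U x∈
... | x∈S , x∈U = x∈p∩q⁺ (S⊆T x∈S , x∈U)

∩-distrib-∩ : ∀ (S T U : Subset n) → (S ∩ T) ∩ U ≡ (S ∩ U) ∩ (T ∩ U)
∩-distrib-∩ S T U = ⊆-antisym
  (λ x∈ → x∈p∩q⁺ (∩-mono U (p∩q⊆p S T) x∈ , ∩-mono U (p∩q⊆q S T) x∈))
  (λ x∈ → let (x∈SU , x∈TU) = x∈p∩q⁻ (S ∩ U) (T ∩ U) x∈ in
    x∈p∩q⁺ (x∈p∩q⁺ (p∩q⊆p S U x∈SU , p∩q⊆p T U x∈TU) , p∩q⊆q S U x∈SU))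

size-∩ : ∀ (S P Q : Subset n) →
  ∣ S ∩ P ∣ ℕ.+ ∣ S ∩ Q ∣ ℕ.≤ ∣ S ∣ ℕ.+ ∣ S ∩ (P ∩ Q) ∣
size-∩ [] [] [] = z≤n
size-∩ (outside ∷ S) (_ ∷ P) (_ ∷ Q) = size-∩ S P Q
size-∩ (inside ∷ S) (outside ∷ P) (outside ∷ Q) = ℕₚ.m≤n⇒m≤1+n (size-∩ S P Q)
size-∩ (inside ∷ S) (inside ∷ P) (outside ∷ Q) = s≤s (size-∩ S P Q)
size-∩ (inside ∷ S) (outside ∷ P) (inside ∷ Q) =
  ℕₚ.≤-trans (ℕₚ.≤-reflexive (ℕₚ.+-suc ∣ S ∩ P ∣ _)) (s≤s (size-∩ S P Q))
size-∩ (inside ∷ S) (inside ∷ P) (inside ∷ Q) =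
  s≤s (subst₂ ℕ._≤_ (sym (ℕₚ.+-suc ∣ S ∩ P ∣ _)) (sym (ℕₚ.+-suc ∣ S ∣ _))
    (s≤s (size-∩ S P Q)))

g∉p-g : ∀ (p : Subset n) g → g ∉ p ∖ g
g∉p-g (_ ∷ p) zero ()
g∉p-g (_ ∷ p) (suc g) (there g∈) = g∉p-g p g g∈

monus-+ : ∀ {x y p q} → p ℕ.≤ x → q ℕ.≤ y →
  (x ℕ.∸ p) ℕ.+ (y ℕ.∸ q) ≡ (x ℕ.+ y) ℕ.∸ (p ℕ.+ q)
monus-+ {x} {y} {p} {q} p≤x q≤y = begin
  (x ℕ.∸ p) ℕ.+ (y ℕ.∸ q)   ≡⟨ sym (ℕₚ.+-∸-assoc (x ℕ.∸ p) q≤y) ⟩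
  ((x ℕ.∸ p) ℕ.+ y) ℕ.∸ q   ≡⟨ cong (ℕ._∸ q) (sym (ℕₚ.+-∸-comm y p≤x)) ⟩
  ((x ℕ.+ y) ℕ.∸ p) ℕ.∸ q   ≡⟨ ℕₚ.∸-+-assoc (x ℕ.+ y) p q ⟩
  (x ℕ.+ y) ℕ.∸ (p ℕ.+ q) ∎
  where open Relation.Binary.PropositionalEquality.≡-Reasoning

monus-≤ : ∀ {x y p q} → p ℕ.≤ x → q ℕ.≤ y → x ℕ.+ q ℕ.≤ y ℕ.+ p →
  x ℕ.∸ p ℕ.≤ y ℕ.∸ q
monus-≤ {x} {y} {p} {q} p≤x q≤y le = begin
  x ℕ.∸ p                           ≡⟨ sym (ℕₚ.[m+n]∸[m+o]≡n∸o q x p) ⟩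
  (q ℕ.+ x) ℕ.∸ (q ℕ.+ p)           ≡⟨ cong (ℕ._∸ (q ℕ.+ p)) (ℕₚ.+-comm q x) ⟩
  (x ℕ.+ q) ℕ.∸ (q ℕ.+ p)           ≤⟨ ℕₚ.∸-monoˡ-≤ (q ℕ.+ p) le ⟩
  (y ℕ.+ p) ℕ.∸ (q ℕ.+ p)           ≡⟨ cong₂ ℕ._∸_ (ℕₚ.+-comm y p) (ℕₚ.+-comm q p) ⟩
  (p ℕ.+ y) ℕ.∸ (p ℕ.+ q)           ≡⟨ ℕₚ.[m+n]∸[m+o]≡n∸o p y q ⟩
  y ℕ.∸ q ∎
  where open ℕₚ.≤-Reasoning

module _ (L M : Matroid n) (g : Fin n) (h : TwoSummable L M g) where

  open TwoSummable h

  private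
    module L = Matroid L
    module M = Matroid M

    g∈∩ : g ∈ L.E ∩ M.E
    g∈∩ = subst (g ∈_) (sym E∩E≡g) (x∈⁅x⁆ g)

    module CL = Closure L (p∩q⊆p L.E M.E g∈∩)
    module CM = Closure M (p∩q⊆q L.E M.E g∈∩)

    ν′ = ν L M g
    rank′ : Subset n → ℕ
    rank′ S = L.rank (S ∩ L.E) ℕ.+ M.rank (S ∩ M.E)

    Both : Pred (Subset n) 0ℓ
    Both S = g L.∈cl S ∩ L.E × g M.∈cl S ∩ M.E

    ν-yes : ∀ {S} → Both S → ν′ S ≡ 1
    ν-yes {S} p = cong (λ b → if b then 1 else 0) (dec-true (ν? L M g S) p)

    ν-no : ∀ {S} → ¬ Both S → ν′ S ≡ 0
    ν-no {S} ¬p = cong (λ b → if b then 1 else 0) (dec-false (ν? L M g S) ¬p)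

  ν≤ : ∀ S → ν L M g S ℕ.≤ L.rank (S ∩ L.E) ℕ.+ M.rank (S ∩ M.E)
  ν≤ S with ν? L M g S
  ... | no ¬p = ℕₚ.≤-trans (ℕₚ.≤-reflexive (ν-no ¬p)) z≤n
  ... | yes p = ℕₚ.≤-trans (ℕₚ.≤-reflexive (ν-yes p)) (ℕₚ.≤-trans
    (CL.cl⇒rank-pos ¬loopˡ (p∩q⊆q S L.E) (proj₁ p)) (ℕₚ.m≤m+n _ _))

  private

    mono : ∀ {S T} → S ⊆ T → rank′ S ℕ.+ ν′ T ℕ.≤ rank′ T ℕ.+ ν′ S
    mono {S} {T} S⊆T = go (ν? L M g S) (ν? L M g T)
      where
      l = L.rank-mono (∩-mono L.E S⊆T) (p∩q⊆q T L.E)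
      m = M.rank-mono (∩-mono M.E S⊆T) (p∩q⊆q T M.E)

      go : Dec (Both S) → Dec (Both T) →
           rank′ S ℕ.+ ν′ T ℕ.≤ rank′ T ℕ.+ ν′ S
      go _ (no ¬t) rewrite ν-no ¬t = subst (ℕ._≤ rank′ T ℕ.+ ν′ S)
        (sym (ℕₚ.+-identityʳ _)) (ℕₚ.m≤n⇒m≤n+o _ (ℕₚ.+-mono-≤ l m))
      go (yes s) (yes t) rewrite ν-yes s | ν-yes t =
        ℕₚ.+-monoˡ-≤ 1 (ℕₚ.+-mono-≤ l m)
      go (no ¬s) (yes (tl , tm)) rewrite ν-no ¬s | ν-yes (tl , tm) =
        subst₂ ℕ._≤_ (ℕₚ.+-comm 1 _) (sym (ℕₚ.+-identityʳ _)) strict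
        where
        strict : rank′ S ℕ.< rank′ T
        strict with g L.∈cl? (S ∩ L.E)
        ... | no ¬p = ℕₚ.+-mono-<-≤
              (CL.cl-strict (∩-mono L.E S⊆T) (p∩q⊆q T L.E) ¬p tl) m
        ... | yes p = ℕₚ.+-mono-≤-< l
              (CM.cl-strict (∩-mono M.E S⊆T) (p∩q⊆q T M.E) (¬s ∘ (p ,_)) tm)

    interchange : ∀ a b c d → (a ℕ.+ c) ℕ.+ (b ℕ.+ d) ≡ (a ℕ.+ b) ℕ.+ (c ℕ.+ d)
    interchange = solve-∀

    submodular : ∀ S T →
      (rank′ (S ∪ T) ℕ.+ rank′ (S ∩ T)) ℕ.+ (ν′ S ℕ.+ ν′ T) ℕ.≤
      (rank′ S ℕ.+ rank′ T) ℕ.+ (ν′ (S ∪ T) ℕ.+ ν′ (S ∩ T))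
    submodular S T = go (ν? L M g S) (ν? L M g T)
                        (ν? L M g (S ∪ T)) (ν? L M g (S ∩ T))
      where
      SL = S ∩ L.E
      TL = T ∩ L.E
      SM = S ∩ M.E
      TM = T ∩ M.E

      a = L.rank SL
      b = L.rank TL
      c = M.rank SM
      d = M.rank TM

      U I : ℕ
      U = rank′ (S ∪ T)
      I = rank′ (S ∩ T)

      expand : U ℕ.+ I ≡ (L.rank (SL ∪ TL) ℕ.+ L.rank (SL ∩ TL))
                     ℕ.+ (M.rank (SM ∪ TM) ℕ.+ M.rank (SM ∩ TM))
      expand rewrite ∩-distribʳ-∪ L.E S T | ∩-distribʳ-∪ M.E S T
                   | ∩-distrib-∩ S T L.E | ∩-distrib-∩ S T M.E
        = interchange (L.rank (SL ∪ TL)) _ _ _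

      l = L.rank-submodular (p∩q⊆q S L.E) (p∩q⊆q T L.E)
      m = M.rank-submodular (p∩q⊆q S M.E) (p∩q⊆q T M.E)

      weak : U ℕ.+ I ℕ.≤ rank′ S ℕ.+ rank′ T
      weak = subst₂ ℕ._≤_ (sym expand) (sym (interchange a b c d)) (ℕₚ.+-mono-≤ l m)

      strictˡ : g L.∈cl SL → g L.∈cl TL → ¬ g L.∈cl ((S ∩ T) ∩ L.E) →
                U ℕ.+ I ℕ.< rank′ S ℕ.+ rank′ T
      strictˡ p q r = subst₂ ℕ._<_ (sym expand) (sym (interchange a b c d))
        (ℕₚ.+-mono-<-≤ (CL.cl-submodular-strict (p∩q⊆q S L.E) (p∩q⊆q T L.E) p q
          (r ∘ subst (g L.∈cl_) (sym (∩-distrib-∩ S T L.E)))) m)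

      strictʳ : g M.∈cl SM → g M.∈cl TM → ¬ g M.∈cl ((S ∩ T) ∩ M.E) →
                U ℕ.+ I ℕ.< rank′ S ℕ.+ rank′ T
      strictʳ p q r = subst₂ ℕ._<_ (sym expand) (sym (interchange a b c d))
        (ℕₚ.+-mono-≤-< l (CM.cl-submodular-strict (p∩q⊆q S M.E) (p∩q⊆q T M.E) p q
          (r ∘ subst (g M.∈cl_) (sym (∩-distrib-∩ S T M.E)))))

      up : ∀ {X Y} → X ⊆ Y → Both X → Both Y
      up {X} {Y} X⊆Y (p , q) = CL.cl-mono (∩-mono L.E X⊆Y) (p∩q⊆q Y L.E) p
                             , CM.cl-mono (∩-mono M.E X⊆Y) (p∩q⊆q Y M.E) q

      go : Dec (Both S) → Dec (Both T) → Dec (Both (S ∪ T)) → Dec (Both (S ∩ T)) →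
           (U ℕ.+ I) ℕ.+ (ν′ S ℕ.+ ν′ T) ℕ.≤
           (rank′ S ℕ.+ rank′ T) ℕ.+ (ν′ (S ∪ T) ℕ.+ ν′ (S ∩ T))
      go (no ¬s) (no ¬t) _ _ rewrite ν-no ¬s | ν-no ¬t = ℕₚ.+-mono-≤ weak z≤n
      go (yes s) _ (no ¬u) _ = contradiction (up (p⊆p∪q T) s) ¬u
      go (no _) (yes t) (no ¬u) _ = contradiction (up (q⊆p∪q S T) t) ¬u
      go (no ¬s) (yes t) (yes u) _ rewrite ν-no ¬s | ν-yes t | ν-yes u =
        ℕₚ.+-mono-≤ weak (s≤s z≤n)
      go (yes s) (no ¬t) (yes u) _ rewrite ν-yes s | ν-no ¬t | ν-yes u =
        ℕₚ.+-mono-≤ weak (s≤s z≤n)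
      go (yes s) (yes t) (yes u) (yes i)
        rewrite ν-yes s | ν-yes t | ν-yes u | ν-yes i = ℕₚ.+-monoˡ-≤ 2 weak
      go (yes (p , p′)) (yes (q , q′)) (yes u) (no ¬i)
        rewrite ν-yes (p , p′) | ν-yes (q , q′) | ν-yes u | ν-no ¬i =
        ℕₚ.≤-trans (ℕₚ.≤-reflexive (ℕₚ.+-suc (U ℕ.+ I) 1)) (ℕₚ.+-monoˡ-≤ 1 strict)
        where
        strict : U ℕ.+ I ℕ.< rank′ S ℕ.+ rank′ T
        strict with g L.∈cl? ((S ∩ T) ∩ L.E)
        ... | no ¬r = strictˡ p q ¬r
        ... | yes r = strictʳ p′ q′ (¬i ∘ (r ,_))

  twoSum : Matroid n
  twoSum = record
    { E               = twoSumE L M g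
    ; rank            = twoSumRank L M g
    ; rank-≤-size     = λ {S} S⊆ → bound S S⊆
    ; rank-mono       = λ {S} {T} S⊆T _ → monus-≤ (ν≤ S) (ν≤ T) (mono S⊆T)
    ; rank-submodular = λ {S} {T} _ _ → subst₂ ℕ._≤_
        (sym (monus-+ (ν≤ (S ∪ T)) (ν≤ (S ∩ T)))) (sym (monus-+ (ν≤ S) (ν≤ T)))
        (monus-≤ (ℕₚ.+-mono-≤ (ν≤ (S ∪ T)) (ν≤ (S ∩ T)))
                 (ℕₚ.+-mono-≤ (ν≤ S) (ν≤ T)) (submodular S T))
    }
    where
    bound : ∀ S → S ⊆ twoSumE L M g → twoSumRank L M g S ℕ.≤ ∣ S ∣
    bound S S⊆ = begin
      rank′ S ℕ.∸ ν′ S                   ≤⟨ ℕₚ.m∸n≤m (rank′ S) (ν′ S) ⟩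
      rank′ S                            ≤⟨ ℕₚ.+-mono-≤ (L.rank-≤-size (p∩q⊆q S L.E))
                                                         (M.rank-≤-size (p∩q⊆q S M.E)) ⟩
      ∣ S ∩ L.E ∣ ℕ.+ ∣ S ∩ M.E ∣        ≤⟨ size-∩ S L.E M.E ⟩
      ∣ S ∣ ℕ.+ ∣ S ∩ (L.E ∩ M.E) ∣      ≡⟨ cong (λ X → ∣ S ∣ ℕ.+ ∣ S ∩ X ∣) E∩E≡g ⟩
      ∣ S ∣ ℕ.+ ∣ S ∩ ⁅ g ⁆ ∣            ≡⟨ cong (λ X → ∣ S ∣ ℕ.+ ∣ X ∣) (Empty-unique empty) ⟩
      ∣ S ∣ ℕ.+ ∣ Data.Fin.Subset.⊥ {n} ∣ ≡⟨ cong (∣ S ∣ ℕ.+_) (∣⊥∣≡0 n) ⟩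
      ∣ S ∣ ℕ.+ 0                        ≡⟨ ℕₚ.+-identityʳ _ ⟩
      ∣ S ∣ ∎
      where
      open ℕₚ.≤-Reasoning
      empty : Data.Fin.Subset.Empty (S ∩ ⁅ g ⁆)
      empty (x , x∈) with x∈p∩q⁻ S ⁅ g ⁆ x∈
      ... | x∈S , x∈g with x∈⁅y⁆⇒x≡y g x∈g
      ... | refl = g∉p-g (L.E ∪ M.E) g (S⊆ x∈S)

module _ {c ℓ₁ ℓ₂} (ℝ : RealField c ℓ₁ ℓ₂) where

  open RealField ℝ

  -- A multiaffine polynomial in indeterminates indexed by a set E is given
  -- by its coefficients Z S, for S ⊆ E, with Z S the coefficient of the
  -- product of the indeterminates in S.  Values Z S for S ⊈ E are ignored.
  MultiaffinePoly : ℕ → Set c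
  MultiaffinePoly n = Subset n → Carrier

  monomial : Subset n → (Fin n → Carrier) → Carrier
  monomial []            y = 1#
  monomial (inside  ∷ S) y = y zero * monomial S (y ∘ suc)
  monomial (outside ∷ S) y = monomial S (y ∘ suc)

  sumSubsets : (E : Subset n) → (Subset n → Carrier) → Carrier
  sumSubsets []            f = f []
  sumSubsets (inside  ∷ E) f = sumSubsets E (f ∘ (inside ∷_)) + sumSubsets E (f ∘ (outside ∷_))
  sumSubsets (outside ∷ E) f = sumSubsets E (f ∘ (outside ∷_))

  eval : (E : Subset n) → MultiaffinePoly n → (Fin n → Carrier) → Carrier
  eval E Z y = sumSubsets E (λ S → Z S * monomial S y)

  ∂ : Fin n → MultiaffinePoly n → MultiaffinePoly n
  ∂ e Z S = if does (e ∈? S) then 0# else Z (S ∪ ⁅ e ⁆)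

  Δ : (E : Subset n) → MultiaffinePoly n → (e f : Fin n) → (Fin n → Carrier) → Carrier
  Δ E Z e f y = (eval E (∂ e Z) y * eval E (∂ f Z) y) - (eval E (∂ f (∂ e Z)) y * eval E Z y)

  record Rayleigh (E : Subset n) (Z : MultiaffinePoly n) : Set (c ⊔ ℓ₁ ⊔ ℓ₂) where
    field
      nonneg  : ∀ S → S ⊆ E → 0# ≤ Z S
      nonzero : ∃[ S ] (S ⊆ E × Z S # 0#)
      Δ≥0     : ∀ e f → e ∈ E → f ∈ E → e ≢ f →
                ∀ y → (∀ i → i ∈ E → 0# < y i) → 0# ≤ Δ E Z e f y

  familyPoly : ∀ {ℓ} {Q : Pred (Subset n) ℓ} → Decidable Q → MultiaffinePoly n
  familyPoly Q? S = if does (Q? S) then 1# else 0#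

  pottsPoly : Matroid n → (q : Carrier) → 0# < q → MultiaffinePoly n
  pottsPoly M q 0<q S = (q ⁻¹[ 0<q ]) ^ Matroid.rank M S

  B-Rayleigh I-Rayleigh S-Rayleigh Potts-Rayleigh : Matroid n → Set (c ⊔ ℓ₁ ⊔ ℓ₂)
  B-Rayleigh M = Rayleigh (Matroid.E M) (familyPoly (Matroid.basis? M))
  I-Rayleigh M = Rayleigh (Matroid.E M) (familyPoly (Matroid.independent? M))
  S-Rayleigh M = Rayleigh (Matroid.E M) (familyPoly (Matroid.spanning? M))
  Potts-Rayleigh M = ∃[ q* ] (0# < q* × (∀ q (0<q : 0# < q) → q ≤ q* →
                       Rayleigh (Matroid.E M) (pottsPoly M q 0<q)))

{-# OPTIONS --safe #-}
-- Write Z_L = Lᵍ + y_g L_g with Lᵍ and L_g free of y_g, and likewise Z_M.  In all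
-- four cases the polynomial of the two-sum is bilinear in the two sides,
--
--   Z = k (Lᵍ M_g + L_g Mᵍ − α Lᵍ Mᵍ − β L_g M_g),
--
-- with (k, α, β) = (1, 0, 0) for bases, (1, 0, 1) for independent sets, (1, 1, 0)
-- for spanning sets and (q/(1−q), 1, q) for the Potts model.  If e and f both lie
-- on the side of L, then u = M_g − α Mᵍ and v = Mᵍ − β M_g are positive and Z is
-- k u times Z_L at y_g = v/u, so ΔZ{e,f} = (k u)² ΔZ_L{e,f}.  If e lies on the side
-- of L and f on that of M, then ΔZ{e,f} = k² (1 − αβ) ΔZ_L{e,g} ΔZ_M{f,g}.
module Submission where

open import Defs
open import Algebra.Apartness.Bundles using (HeytingField)
open import Algebra.Bundles using (CommutativeRing; RawRing)
import Algebra.Solver.Ring as RingSolver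
open import Algebra.Solver.Ring.AlmostCommutativeRing
  using (fromCommutativeRing; _-Raw-AlmostCommutative⟶_)
open import Data.Bool.Base using (true; false; if_then_else_)
open import Data.Empty using (⊥-elim)
open import Data.Fin.Base using (Fin; zero; suc)
open import Data.Fin.Properties using (_≟_; any?)
open import Data.Fin.Subset
  using (Subset; inside; outside; _∈_; _∉_; _⊆_; _∪_; _∩_; ⁅_⁆; ∣_∣; ⊥)
  renaming (_-_ to _∖_)
open import Data.Fin.Subset.Properties
open import Data.Maybe.Base using (Maybe; just; nothing)
open import Data.Nat.Base as ℕ using (ℕ; zero; suc)
import Data.Nat.Properties as ℕₚ
open import Data.Product.Base using (∃-syntax; _×_; _,_; proj₁; proj₂)
open import Data.Sum.Base using (_⊎_; inj₁; inj₂; [_,_]′)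
open import Data.Vec.Base using ([]; _∷_; here; there)
open import Function.Base using (_∘_; id)
open import Function.Bundles using (_⇔_; mk⇔; Equivalence)
open import Level using (Level; _⊔_)
open import Relation.Binary.PropositionalEquality as ≡ using (_≡_; _≢_)
open import Relation.Binary.Structures using (IsStrictPartialOrder)
open import Relation.Nullary
  using (¬_; Dec; yes; no; does; contradiction; _×-dec_; _⊎-dec_; ¬?)
open import Relation.Nullary.Decidable using (dec-true; dec-false; does-⇔)

-- The constants are forced by what adjoining `g` does on each side. A basis of the two-sum splits
-- in two mutually exclusive ways. For independent sets the two ways overlap exactly when both parts
-- stay independent with `g`, for spanning sets exactly when both parts span without `g`, and
-- inclusion-exclusion subtracts L_g M_g or Lᵍ Mᵍ. In the Potts model a part contributes a multiple
-- of (1, 1) if its closure contains `g` and of (1, 1/q) if not; these vectors must pair to q when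
-- both are of the first kind and to 1 otherwise, which is three linear equations in k, kα and kβ.
-- The conditions on `g` yield strict positivity: u > 0 because `g` is not a loop, v > 0 because it
-- is not a coloop. Since the order of the reals is not decidable, both are traced back to
-- coefficients known to be either zero or positive.

private
  variable
    n : ℕ

-- Finite subsets

module SubsetProperties where
  open ≡ using (refl; sym; trans; cong; subst)

  ∪⊆ : {S T U : Subset n} → S ⊆ U → T ⊆ U → S ∪ T ⊆ U
  ∪⊆ {S = S} {T} p q = [ p , q ]′ ∘ x∈p∪q⁻ S T

  ⁅⁆⊆ : {S : Subset n} {e : Fin n} → e ∈ S → ⁅ e ⁆ ⊆ S
  ⁅⁆⊆ {S = S} e∈S x∈e = subst (_∈ S) (sym (x∈⁅y⁆⇒x≡y _ x∈e)) e∈S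

  e∈S∪e : (S : Subset n) (e : Fin n) → e ∈ S ∪ ⁅ e ⁆
  e∈S∪e S e = q⊆p∪q S ⁅ e ⁆ (x∈⁅x⁆ e)

  ∉∪⁅⁆ : {S : Subset n} {e f : Fin n} → e ∉ S → e ≢ f → e ∉ S ∪ ⁅ f ⁆
  ∉∪⁅⁆ {S = S} {e} {f} e∉S e≢f = [ e∉S , e≢f ∘ x∈⁅y⁆⇒x≡y f ]′ ∘ x∈p∪q⁻ S ⁅ f ⁆

  ∖-∪⁅⁆ : {T : Subset n} {e : Fin n} → e ∈ T → (T ∖ e) ∪ ⁅ e ⁆ ≡ T
  ∖-∪⁅⁆ {T = T} {e} e∈T = ⊆-antisym (∪⊆ (p─q⊆p T ⁅ e ⁆) (⁅⁆⊆ e∈T)) λ {x} x∈T → back x∈T (x ≟ e)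
    where
    back : ∀ {x} → x ∈ T → Dec (x ≡ e) → x ∈ (T ∖ e) ∪ ⁅ e ⁆
    back x∈T (yes refl) = e∈S∪e _ e
    back x∈T (no x≢e)   = p⊆p∪q _ (x∈p∧x≢y⇒x∈p-y x∈T x≢e)

  ∖-mono : {S T : Subset n} {e : Fin n} → S ⊆ T → S ∖ e ⊆ T ∖ e
  ∖-mono {S = S} {e = e} S⊆T x∈ = x∈p∧x≢y⇒x∈p-y (S⊆T (p─q⊆p S _ x∈)) λ { refl → g∉p-g S e x∈ }

  ∣∪⁅⁆∣ : {S : Subset n} {e : Fin n} → e ∉ S → ∣ S ∪ ⁅ e ⁆ ∣ ≡ suc ∣ S ∣
  ∣∪⁅⁆∣ {S = inside  ∷ S} {zero}  e∉S = contradiction here e∉S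
  ∣∪⁅⁆∣ {S = outside ∷ S} {zero}  e∉S = cong (suc ∘ ∣_∣) (∪-identityʳ S)
  ∣∪⁅⁆∣ {S = inside  ∷ S} {suc e} e∉S = cong suc (∣∪⁅⁆∣ (e∉S ∘ there))
  ∣∪⁅⁆∣ {S = outside ∷ S} {suc e} e∉S = ∣∪⁅⁆∣ (e∉S ∘ there)

  ∪⁅⁆-∩ : {S A : Subset n} {e : Fin n} → e ∈ A → (S ∪ ⁅ e ⁆) ∩ A ≡ (S ∩ A) ∪ ⁅ e ⁆
  ∪⁅⁆-∩ {S = S} {A} {e} e∈A = trans (∩-distribʳ-∪ A S ⁅ e ⁆)
    (cong (S ∩ A ∪_) (⊆-antisym (p∩q⊆p ⁅ e ⁆ A) λ x∈e → x∈p∩q⁺ (x∈e , ⁅⁆⊆ e∈A x∈e)))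

  ∪⁅⁆-∩-∉ : {S A : Subset n} {e : Fin n} → e ∉ A → (S ∪ ⁅ e ⁆) ∩ A ≡ S ∩ A
  ∪⁅⁆-∩-∉ {S = S} {A} {e} e∉A = ⊆-antisym
    (λ x∈ → let (x∈S∪e , x∈A) = x∈p∩q⁻ _ A x∈ in
       [ (λ x∈S → x∈p∩q⁺ (x∈S , x∈A))
       , (λ x∈e → contradiction (subst (_∈ A) (x∈⁅y⁆⇒x≡y e x∈e) x∈A) e∉A) ]′ (x∈p∪q⁻ S _ x∈S∪e))
    (∩-mono A (p⊆p∪q ⁅ e ⁆))

  ∪-∖ : (P Q : Subset n) (e : Fin n) → (P ∪ Q) ∖ e ≡ (P ∖ e) ∪ (Q ∖ e)
  ∪-∖ P Q e = ⊆-antisym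
    (λ x∈ → [ p⊆p∪q _ ∘ keep x∈ , q⊆p∪q (P ∖ e) _ ∘ keep x∈ ]′ (x∈p∪q⁻ P Q (p─q⊆p _ _ x∈)))
    (∪⊆ (λ x∈ → x∈p∧x≢y⇒x∈p-y (p⊆p∪q Q (p─q⊆p P _ x∈)) (∖-≢ P x∈))
        (λ x∈ → x∈p∧x≢y⇒x∈p-y (q⊆p∪q P Q (p─q⊆p Q _ x∈)) (∖-≢ Q x∈)))
    where
    ∖-≢ : ∀ {x} (R : Subset _) → x ∈ R ∖ e → x ≢ e
    ∖-≢ R x∈ refl = g∉p-g R e x∈
    keep : ∀ {x} {R R′ : Subset _} → x ∈ R ∖ e → x ∈ R′ → x ∈ R′ ∖ e
    keep {R = R} x∈ x∈R′ = x∈p∧x≢y⇒x∈p-y x∈R′ (∖-≢ R x∈)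

  ∩-∖ : {S : Subset n} {e : Fin n} (P : Subset n) → e ∉ S → S ∩ (P ∖ e) ≡ S ∩ P
  ∩-∖ {S = S} P e∉S = ⊆-antisym
    (λ x∈ → let (x∈S , x∈P) = x∈p∩q⁻ S _ x∈ in x∈p∩q⁺ (x∈S , p─q⊆p P _ x∈P))
    (λ x∈ → let (x∈S , x∈P) = x∈p∩q⁻ S _ x∈ in
       x∈p∩q⁺ (x∈S , x∈p∧x≢y⇒x∈p-y x∈P λ { refl → e∉S x∈S }))

  Disjoint : Subset n → Subset n → Set
  Disjoint A B = ∀ {x} → x ∈ A → x ∉ B

  drop-∷-disjoint : ∀ {a b} {A B : Subset n} → Disjoint (a ∷ A) (b ∷ B) → Disjoint A B
  drop-∷-disjoint dis x∈A x∈B = dis (there x∈A) (there x∈B)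

  ∣∩∣+∣∩∣ : {A B S : Subset n} → Disjoint A B → S ⊆ A ∪ B → ∣ S ∩ A ∣ ℕ.+ ∣ S ∩ B ∣ ≡ ∣ S ∣
  ∣∩∣+∣∩∣ {A = []} {[]} {[]} _ _ = refl
  ∣∩∣+∣∩∣ {A = a ∷ A} {b ∷ B} {outside ∷ S} dis S⊆ =
    ∣∩∣+∣∩∣ (drop-∷-disjoint dis) (drop-∷-⊆ S⊆)
  ∣∩∣+∣∩∣ {A = inside ∷ A} {inside ∷ B} {inside ∷ S} dis S⊆ = contradiction here (dis here)
  ∣∩∣+∣∩∣ {A = inside ∷ A} {outside ∷ B} {inside ∷ S} dis S⊆ =
    cong suc (∣∩∣+∣∩∣ (drop-∷-disjoint dis) (drop-∷-⊆ S⊆))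
  ∣∩∣+∣∩∣ {A = outside ∷ A} {inside ∷ B} {inside ∷ S} dis S⊆ =
    trans (ℕₚ.+-suc ∣ S ∩ A ∣ _) (cong suc (∣∩∣+∣∩∣ (drop-∷-disjoint dis) (drop-∷-⊆ S⊆)))
  ∣∩∣+∣∩∣ {A = outside ∷ A} {outside ∷ B} {inside ∷ S} dis S⊆ with S⊆ here
  ... | ()

  -- Splits a rank equation of the two-sum, in which both summands attain their upper bounds, into
  -- one equation for each side.
  +-≡-split : ∀ {a b c d} → a ℕ.≤ b → c ℕ.≤ d → a ℕ.+ c ≡ b ℕ.+ d → a ≡ b × c ≡ d
  +-≡-split {a} {b} {c} {d} a≤b c≤d eq =
      ℕₚ.≤-antisym a≤b (ℕₚ.≮⇒≥ λ a<b → ℕₚ.<-irrefl eq (ℕₚ.+-mono-<-≤ a<b c≤d))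
    , ℕₚ.≤-antisym c≤d (ℕₚ.≮⇒≥ λ c<d → ℕₚ.<-irrefl eq (ℕₚ.+-mono-≤-< a≤b c<d))

  x∉∖⇒ : {E S : Subset n} {g : Fin n} → S ⊆ E ∖ g → g ∉ S
  x∉∖⇒ {E = E} {g = g} S⊆ = g∉p-g E g ∘ S⊆

open SubsetProperties

-- Matroids

module MatroidProperties (M : Matroid n) where
  open import Data.Nat.Base using (_+_; _≤_)
  open ≡ using (refl; sym; trans; cong; cong₂; subst)
  open Matroid M

  rank-⊥ : rank ⊥ ≡ 0
  rank-⊥ = ℕₚ.n≤0⇒n≡0 (subst (rank ⊥ ≤_) (∣⊥∣≡0 n) (rank-≤-size ⊥⊆))

  independent-⊥ : Independent ⊥
  independent-⊥ = ⊥⊆ , trans rank-⊥ (sym (∣⊥∣≡0 n))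

  rank-∪⁅⁆ : ∀ {S e} → S ⊆ E → e ∈ E →
    rank (S ∪ ⁅ e ⁆) ≡ rank S ⊎ rank (S ∪ ⁅ e ⁆) ≡ suc (rank S)
  rank-∪⁅⁆ {S} {e} S⊆E e∈E with ℕₚ.m≤n⇒m<n∨m≡n (rank-mono (p⊆p∪q ⁅ e ⁆) (∪⊆ S⊆E (⁅⁆⊆ e∈E)))
  ... | inj₂ eq = inj₁ (sym eq)
  ... | inj₁ lt = inj₂ (ℕₚ.≤-antisym (begin
    rank (S ∪ ⁅ e ⁆)                      ≤⟨ ℕₚ.m≤m+n _ _ ⟩
    rank (S ∪ ⁅ e ⁆) + rank (S ∩ ⁅ e ⁆)   ≤⟨ rank-submodular S⊆E (⁅⁆⊆ e∈E) ⟩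
    rank S + rank ⁅ e ⁆                   ≤⟨ ℕₚ.+-monoʳ-≤ (rank S) (rank-≤-size (⁅⁆⊆ e∈E)) ⟩
    rank S + ∣ ⁅ e ⁆ ∣                    ≡⟨ cong (rank S +_) (∣⁅x⁆∣≡1 e) ⟩
    rank S + 1                            ≡⟨ ℕₚ.+-comm (rank S) 1 ⟩
    suc (rank S) ∎) lt)
    where open ℕₚ.≤-Reasoning

  -- The freedom in `S` and `T` serves two purposes: removing `g` from `T` gives a basis avoiding
  -- `g`, and starting from the singleton of `g` gives a basis through it. The induction removes
  -- from `T` an element outside `S`; its first argument bounds the size of `T`.
  extend : ∀ {S} → Independent S → ∀ T → S ⊆ T → T ⊆ E →
    ∃[ B ] (S ⊆ B × B ⊆ T × Independent B × rank B ≡ rank T)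
  extend {S} indep T = go ∣ T ∣ T ℕₚ.≤-refl
    where
    go : ∀ k T → ∣ T ∣ ≤ k → S ⊆ T → T ⊆ E →
      ∃[ B ] (S ⊆ B × B ⊆ T × Independent B × rank B ≡ rank T)
    go k T ∣T∣≤k S⊆T T⊆E with any? (λ e → (e ∈? T) ×-dec ¬? (e ∈? S))
    go k T ∣T∣≤k S⊆T T⊆E | no ¬e = S , id , S⊆T , indep , cong rank (⊆-antisym S⊆T T⊆S)
      where
      T⊆S : T ⊆ S
      T⊆S {x} x∈T with x ∈? S
      ... | yes x∈S = x∈S
      ... | no  x∉S = contradiction (x , x∈T , x∉S) ¬e
    go zero T ∣T∣≤k S⊆T T⊆E | yes (e , e∈T , e∉S) =
      contradiction (ℕₚ.<-≤-trans (x∈p⇒∣p-x∣<∣p∣ e∈T) ∣T∣≤k) λ ()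
    go (suc k) T ∣T∣≤k S⊆T T⊆E | yes (e , e∈T , e∉S)
      with go k (T ∖ e) (ℕₚ.≤-pred (ℕₚ.<-≤-trans (x∈p⇒∣p-x∣<∣p∣ e∈T) ∣T∣≤k))
             (λ x∈S → x∈p∧x≢y⇒x∈p-y (S⊆T x∈S) λ { refl → e∉S x∈S }) (T⊆E ∘ p─q⊆p T ⁅ e ⁆)
    ... | B , S⊆B , B⊆ , (B⊆E , rB) , rB≡ with rank-∪⁅⁆ B⊆E (T⊆E e∈T)
    -- `e` lies in the closure of `B`, hence by monotonicity in that of `T ∖ e`, so putting it back
    -- does not raise the rank of `T ∖ e`.
    ...   | inj₁ closed = B , S⊆B , p─q⊆p T ⁅ e ⁆ ∘ B⊆ , (B⊆E , rB) , trans rB≡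
              (trans (sym (proj₂ (Closure.cl-mono M (T⊆E e∈T) B⊆ (T⊆E ∘ p─q⊆p T ⁅ e ⁆)
                            (T⊆E e∈T , closed))))
                     (cong rank (∖-∪⁅⁆ e∈T)))
    -- Adjoining `e` raises the rank of `B` by one, and that of `T ∖ e` by at most one, so
    -- `B ∪ ⁅ e ⁆` catches up with `T`.
    ...   | inj₂ open′ = B ∪ ⁅ e ⁆ , p⊆p∪q ⁅ e ⁆ ∘ S⊆B , B∪e⊆T
              , (T⊆E ∘ B∪e⊆T , trans open′ (trans (cong suc rB) (sym (∣∪⁅⁆∣ (x∉∖⇒ B⊆)))))
              , ℕₚ.≤-antisym (rank-mono B∪e⊆T T⊆E) (begin
                  rank T                    ≡⟨ cong rank (∖-∪⁅⁆ e∈T) ⟨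
                  rank ((T ∖ e) ∪ ⁅ e ⁆)    ≤⟨ [ ℕₚ.m≤n⇒m≤1+n ∘ ℕₚ.≤-reflexive , ℕₚ.≤-reflexive ]′
                                                 (rank-∪⁅⁆ (T⊆E ∘ p─q⊆p T ⁅ e ⁆) (T⊆E e∈T)) ⟩
                  suc (rank (T ∖ e))        ≡⟨ cong suc rB≡ ⟨
                  suc (rank B)              ≡⟨ open′ ⟨
                  rank (B ∪ ⁅ e ⁆) ∎)
      where
      open ℕₚ.≤-Reasoning
      B∪e⊆T : B ∪ ⁅ e ⁆ ⊆ T
      B∪e⊆T = ∪⊆ (p─q⊆p T ⁅ e ⁆ ∘ B⊆) (⁅⁆⊆ e∈T)

  basis-exists : ∃[ B ] Basis B
  basis-exists = let (B , _ , B⊆E , indep , eq) = extend independent-⊥ E ⊥⊆ id in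
    B , indep , B⊆E , eq

  spanning-E : Spanning E
  spanning-E = id , refl

  independent-⊆ : ∀ {S e} → S ⊆ E → e ∉ S → Independent (S ∪ ⁅ e ⁆) → Independent S
  independent-⊆ {S} {e} S⊆E e∉S (S∪e⊆E , eq) = S⊆E , ℕₚ.≤-antisym (rank-≤-size S⊆E)
    (ℕₚ.≤-pred (begin
      suc ∣ S ∣         ≡⟨ ∣∪⁅⁆∣ e∉S ⟨
      ∣ S ∪ ⁅ e ⁆ ∣     ≡⟨ eq ⟨
      rank (S ∪ ⁅ e ⁆)  ≤⟨ [ ℕₚ.m≤n⇒m≤1+n ∘ ℕₚ.≤-reflexive , ℕₚ.≤-reflexive ]′
                              (rank-∪⁅⁆ S⊆E (S∪e⊆E (e∈S∪e S e))) ⟩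
      suc (rank S) ∎))
    where open ℕₚ.≤-Reasoning

  spanning-⊆ : ∀ {S T} → S ⊆ T → T ⊆ E → Spanning S → Spanning T
  spanning-⊆ S⊆T T⊆E (_ , eq) = T⊆E , ℕₚ.≤-antisym (rank-mono T⊆E id)
    (ℕₚ.≤-trans (ℕₚ.≤-reflexive (sym eq)) (rank-mono S⊆T T⊆E))

  -- An independent set cannot have more elements than the rank of the matroid. This makes the two
  -- kinds of bases of a two-sum exclusive, and it later provides the strictly positive coefficients
  -- for independent and for spanning sets.
  independent-spanning : ∀ {S e} → e ∉ S → Spanning S → ¬ Independent (S ∪ ⁅ e ⁆)
  independent-spanning {S} {e} e∉S (S⊆E , span) (S∪e⊆E , indep) = ℕₚ.<-irrefl refl (begin-strict
    ∣ S ∣             <⟨ ℕₚ.n<1+n ∣ S ∣ ⟩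
    suc ∣ S ∣         ≡⟨ trans indep (∣∪⁅⁆∣ e∉S) ⟨
    rank (S ∪ ⁅ e ⁆)  ≤⟨ rank-mono S∪e⊆E id ⟩
    rank E            ≡⟨ span ⟨
    rank S            ≤⟨ rank-≤-size S⊆E ⟩
    ∣ S ∣ ∎)
    where open ℕₚ.≤-Reasoning

  module _ {g} (g∈E : g ∈ E) where

    ∖⊆E : E ∖ g ⊆ E
    ∖⊆E = p─q⊆p E ⁅ g ⁆

    -- If deleting `g` lowered the rank, no set avoiding `g` could span, so `g` would be in every
    -- basis. Equality of ranks is decidable, which makes this argument by contradiction
    -- constructive.
    rank-∖ : ¬ Coloop g → rank (E ∖ g) ≡ rank E
    rank-∖ ¬coloop with rank (E ∖ g) ℕₚ.≟ rank E
    ... | yes eq = eq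
    ... | no neq = contradiction (g∈E , in-all) ¬coloop
      where
      in-all : ∀ B → Basis B → g ∈ B
      in-all B (_ , B⊆E , span) with g ∈? B
      ... | yes g∈B = g∈B
      ... | no  g∉B = contradiction (ℕₚ.≤-antisym (rank-mono ∖⊆E id)
              (ℕₚ.≤-trans (ℕₚ.≤-reflexive (sym span)) (rank-mono
                (λ x∈B → x∈p∧x≢y⇒x∈p-y (B⊆E x∈B) λ { refl → g∉B x∈B }) ∖⊆E))) neq

    spanning-∖ : ¬ Coloop g → Spanning (E ∖ g)
    spanning-∖ ¬coloop = ∖⊆E , rank-∖ ¬coloop

    ∈cl-∖ : ¬ Coloop g → g ∈cl (E ∖ g)
    ∈cl-∖ ¬coloop = g∈E , trans (cong rank (∖-∪⁅⁆ g∈E)) (sym (rank-∖ ¬coloop))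

    independent-⁅⁆ : ¬ Loop g → Independent ⁅ g ⁆
    independent-⁅⁆ ¬loop = ⁅⁆⊆ g∈E , ℕₚ.≤-antisym (rank-≤-size (⁅⁆⊆ g∈E))
      (ℕₚ.≤-trans (ℕₚ.≤-reflexive (∣⁅x⁆∣≡1 g)) (ℕₚ.n≢0⇒n>0 (¬loop ∘ (g∈E ,_))))

    basis-without : ¬ Coloop g → ∃[ B ] (B ⊆ E ∖ g × Basis B)
    basis-without ¬coloop = let (B , _ , B⊆ , indep , eq) = extend independent-⊥ (E ∖ g) ⊥⊆ ∖⊆E in
      B , B⊆ , indep , ∖⊆E ∘ B⊆ , trans eq (rank-∖ ¬coloop)

    basis-with : ¬ Loop g → ∃[ S ] (S ⊆ E ∖ g × Basis (S ∪ ⁅ g ⁆))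
    basis-with ¬loop =
      let (B , g⊆B , B⊆ , indep , eq) = extend (independent-⁅⁆ ¬loop) E (⁅⁆⊆ g∈E) id in
      B ∖ g , ∖-mono B⊆ , subst Basis (sym (∖-∪⁅⁆ (g⊆B (x∈⁅x⁆ g)))) (indep , B⊆ , eq)

-- Independent sets, spanning sets and bases of a two-sum

module TwoSumProperties (L M : Matroid n) (g : Fin n) (h : TwoSummable L M g) where
  open import Data.Nat.Base using (_+_; _≤_)
  open ≡ using (refl; sym; trans; cong; cong₂; subst)
  open TwoSummable h
  module L = Matroid L
  module M = Matroid M
  module N = Matroid (twoSum L M g h)
  module LP = MatroidProperties L
  module MP = MatroidProperties M

  private
    g∈∩ : g ∈ L.E ∩ M.E
    g∈∩ = subst (g ∈_) (sym E∩E≡g) (x∈⁅x⁆ g)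

  g∈Eˡ : g ∈ L.E
  g∈Eˡ = p∩q⊆p L.E M.E g∈∩

  g∈Eʳ : g ∈ M.E
  g∈Eʳ = p∩q⊆q L.E M.E g∈∩

  A B : Subset n
  A = L.E ∖ g
  B = M.E ∖ g

  E≡ : N.E ≡ A ∪ B
  E≡ = ∪-∖ L.E M.E g

  disjoint : Disjoint A B
  disjoint {x} x∈A x∈B = g∉p-g L.E g (subst (_∈ A)
    (x∈⁅y⁆⇒x≡y g (subst (x ∈_) E∩E≡g (x∈p∩q⁺ (p─q⊆p _ _ x∈A , p─q⊆p _ _ x∈B)))) x∈A)

  module _ {S : Subset n} (S⊆E : S ⊆ N.E) where

    -- Cutting with `A` and `B` instead of the full ground sets makes the two parts disjoint. As `g`
    -- is not in `S`, they are still the sets that occur in the rank function of the two-sum.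
    X Y : Subset n
    X = S ∩ A
    Y = S ∩ B

    X⊆A : X ⊆ A
    X⊆A = p∩q⊆q S A

    Y⊆B : Y ⊆ B
    Y⊆B = p∩q⊆q S B

    X⊆E : X ⊆ L.E
    X⊆E = p─q⊆p L.E ⁅ g ⁆ ∘ X⊆A

    Y⊆E : Y ⊆ M.E
    Y⊆E = p─q⊆p M.E ⁅ g ⁆ ∘ Y⊆B

    g∉X : g ∉ X
    g∉X = x∉∖⇒ X⊆A

    g∉Y : g ∉ Y
    g∉Y = x∉∖⇒ Y⊆B

    X∪g⊆E : X ∪ ⁅ g ⁆ ⊆ L.E
    X∪g⊆E = ∪⊆ X⊆E (⁅⁆⊆ g∈Eˡ)

    Y∪g⊆E : Y ∪ ⁅ g ⁆ ⊆ M.E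
    Y∪g⊆E = ∪⊆ Y⊆E (⁅⁆⊆ g∈Eʳ)

    private
      Xeq : X ≡ S ∩ L.E
      Xeq = ∩-∖ L.E (x∉∖⇒ S⊆E)

      Yeq : Y ≡ S ∩ M.E
      Yeq = ∩-∖ M.E (x∉∖⇒ S⊆E)

      rank′≡ : L.rank (S ∩ L.E) + M.rank (S ∩ M.E) ≡ L.rank X + M.rank Y
      rank′≡ = cong₂ _+_ (cong L.rank (sym Xeq)) (cong M.rank (sym Yeq))

      ν≡ : ∀ b → does (ν? L M g S) ≡ b → ν L M g S ≡ (if b then 1 else 0)
      ν≡ b = cong (if_then 1 else 0)

    -- The successor on the left replaces the truncated subtraction in the rank function; `ν≤`
    -- justifies moving the 1 across.
    rank-closed : g L.∈cl X → g M.∈cl Y → suc (N.rank S) ≡ L.rank X + M.rank Y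
    rank-closed p q = trans (sym (ℕₚ.+-∸-assoc 1 (ν≤ L M g h S)))
      (trans (cong (suc (L.rank (S ∩ L.E) + M.rank (S ∩ M.E)) ℕ.∸_) ν≡1) rank′≡)
      where
      ν≡1 = ν≡ true (dec-true (ν? L M g S) (subst (g L.∈cl_) Xeq p , subst (g M.∈cl_) Yeq q))

    rank-open : ¬ (g L.∈cl X × g M.∈cl Y) → N.rank S ≡ L.rank X + M.rank Y
    rank-open ¬both = trans (cong (L.rank (S ∩ L.E) + M.rank (S ∩ M.E) ℕ.∸_) ν≡0) rank′≡
      where
      ν≡0 = ν≡ false (dec-false (ν? L M g S) λ (p , q) →
        ¬both (subst (g L.∈cl_) (sym Xeq) p , subst (g M.∈cl_) (sym Yeq) q))

    -- c or o for each side, according to whether g lies in the closure of the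
    -- part of S on that side (closed) or not (open).
    data RankCase : Set where
      cc : L.rank (X ∪ ⁅ g ⁆) ≡ L.rank X → M.rank (Y ∪ ⁅ g ⁆) ≡ M.rank Y →
           suc (N.rank S) ≡ L.rank X + M.rank Y → RankCase
      co : L.rank (X ∪ ⁅ g ⁆) ≡ L.rank X → M.rank (Y ∪ ⁅ g ⁆) ≡ suc (M.rank Y) →
           N.rank S ≡ L.rank X + M.rank Y → RankCase
      oc : L.rank (X ∪ ⁅ g ⁆) ≡ suc (L.rank X) → M.rank (Y ∪ ⁅ g ⁆) ≡ M.rank Y →
           N.rank S ≡ L.rank X + M.rank Y → RankCase
      oo : L.rank (X ∪ ⁅ g ⁆) ≡ suc (L.rank X) → M.rank (Y ∪ ⁅ g ⁆) ≡ suc (M.rank Y) →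
           N.rank S ≡ L.rank X + M.rank Y → RankCase

    rankCase : RankCase
    rankCase with LP.rank-∪⁅⁆ X⊆E g∈Eˡ | MP.rank-∪⁅⁆ Y⊆E g∈Eʳ
    ... | inj₁ p | inj₁ q = cc p q (rank-closed (g∈Eˡ , p) (g∈Eʳ , q))
    ... | inj₁ p | inj₂ q = co p q (rank-open λ (_ , _ , q′) → ℕₚ.1+n≢n (trans (sym q) q′))
    ... | inj₂ p | inj₁ q = oc p q (rank-open λ ((_ , p′) , _) → ℕₚ.1+n≢n (trans (sym p) p′))
    ... | inj₂ p | inj₂ q = oo p q (rank-open λ ((_ , p′) , _) → ℕₚ.1+n≢n (trans (sym p) p′))

    private
      size : ∣ X ∣ + ∣ Y ∣ ≡ ∣ S ∣
      size = ∣∩∣+∣∩∣ disjoint (subst (S ⊆_) E≡ S⊆E)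

    -- If `g` is in the closure on both sides, the rank falls short of the size, and neither part
    -- can be independent together with `g`. In every other case the rank is additive, so
    -- independence of `S` is independence of both parts, and a side that is open at `g` stays
    -- independent when `g` is adjoined.
    independent⇔ : N.Independent S ⇔
      (L.Independent X × M.Independent Y × (L.Independent (X ∪ ⁅ g ⁆) ⊎ M.Independent (Y ∪ ⁅ g ⁆)))
    independent⇔ = mk⇔ (λ (_ , eq) → to eq rankCase) back
      where
      x≤ = L.rank-≤-size X⊆E
      y≤ = M.rank-≤-size Y⊆E

      halves : N.rank S ≡ ∣ S ∣ → N.rank S ≡ L.rank X + M.rank Y →
        L.rank X ≡ ∣ X ∣ × M.rank Y ≡ ∣ Y ∣
      halves eq r = +-≡-split x≤ y≤ (trans (sym r) (trans eq (sym size)))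

      to : N.rank S ≡ ∣ S ∣ → RankCase →
        L.Independent X × M.Independent Y × (L.Independent (X ∪ ⁅ g ⁆) ⊎ M.Independent (Y ∪ ⁅ g ⁆))
      to eq (cc _ _ r) = contradiction (ℕₚ.+-mono-≤ x≤ y≤) (ℕₚ.<⇒≱ (ℕₚ.≤-reflexive
        (trans (cong suc (trans size (sym eq))) r)))
      to eq (co p q r) = let (x , y) = halves eq r in (X⊆E , x) , (Y⊆E , y)
        , inj₂ (Y∪g⊆E , trans q (trans (cong suc y) (sym (∣∪⁅⁆∣ g∉Y))))
      to eq (oc p q r) = let (x , y) = halves eq r in (X⊆E , x) , (Y⊆E , y)
        , inj₁ (X∪g⊆E , trans p (trans (cong suc x) (sym (∣∪⁅⁆∣ g∉X))))
      to eq (oo p q r) = let (x , y) = halves eq r in (X⊆E , x) , (Y⊆E , y)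
        , inj₁ (X∪g⊆E , trans p (trans (cong suc x) (sym (∣∪⁅⁆∣ g∉X))))

      from : L.Independent X × M.Independent Y ×
        (L.Independent (X ∪ ⁅ g ⁆) ⊎ M.Independent (Y ∪ ⁅ g ⁆)) →
        RankCase → N.rank S ≡ ∣ S ∣
      from ((_ , x) , _ , inj₁ (_ , x′)) (cc p q r) = contradiction
        (trans (sym (∣∪⁅⁆∣ g∉X)) (trans (sym x′) (trans p x))) ℕₚ.1+n≢n
      from (_ , (_ , y) , inj₂ (_ , y′)) (cc p q r) = contradiction
        (trans (sym (∣∪⁅⁆∣ g∉Y)) (trans (sym y′) (trans q y))) ℕₚ.1+n≢n
      from ((_ , x) , (_ , y) , _) (co p q r) = trans r (trans (cong₂ _+_ x y) size)
      from ((_ , x) , (_ , y) , _) (oc p q r) = trans r (trans (cong₂ _+_ x y) size)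
      from ((_ , x) , (_ , y) , _) (oo p q r) = trans r (trans (cong₂ _+_ x y) size)

      back : L.Independent X × M.Independent Y ×
        (L.Independent (X ∪ ⁅ g ⁆) ⊎ M.Independent (Y ∪ ⁅ g ⁆)) →
        N.Independent S
      back p = S⊆E , from p rankCase

  -- As `g` is not a coloop, it is in the closure of `A` and of `B`, so the whole ground set falls
  -- under `rank-closed`.
  rank-E : suc (N.rank N.E) ≡ L.rank L.E + M.rank M.E
  rank-E = trans
    (rank-closed id (closed Eˡ≡ (LP.∈cl-∖ g∈Eˡ ¬coloopˡ)) (closedʳ Eʳ≡ (MP.∈cl-∖ g∈Eʳ ¬coloopʳ)))
    (cong₂ _+_ (trans (cong L.rank Eˡ≡) (LP.rank-∖ g∈Eˡ ¬coloopˡ))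
               (trans (cong M.rank Eʳ≡) (MP.rank-∖ g∈Eʳ ¬coloopʳ)))
    where
    closed : ∀ {P Q} → P ≡ Q → g L.∈cl Q → g L.∈cl P
    closed refl p = p
    closedʳ : ∀ {P Q} → P ≡ Q → g M.∈cl Q → g M.∈cl P
    closedʳ refl p = p
    Eˡ≡ : N.E ∩ A ≡ A
    Eˡ≡ = ⊆-antisym (p∩q⊆q N.E A) λ x∈A → x∈p∩q⁺ (subst (_ ∈_) (sym E≡) (p⊆p∪q B x∈A) , x∈A)
    Eʳ≡ : N.E ∩ B ≡ B
    Eʳ≡ = ⊆-antisym (p∩q⊆q N.E B) λ x∈B → x∈p∩q⁺ (subst (_ ∈_) (sym E≡) (q⊆p∪q A B x∈B) , x∈B)

  module _ {S : Subset n} (S⊆E : S ⊆ N.E) where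

    private
      X′ = X S⊆E
      Y′ = Y S⊆E

    -- Once `g` is adjoined to both parts, their ranks add up to `suc (N.rank S)` unless both sides
    -- are open, and `rank-E` is the same relation for the ground sets. A closed side spans already
    -- without `g`.
    spanning⇔ : N.Spanning S ⇔
      (L.Spanning (X′ ∪ ⁅ g ⁆) × M.Spanning (Y′ ∪ ⁅ g ⁆) × (L.Spanning X′ ⊎ M.Spanning Y′))
    spanning⇔ = mk⇔ (λ (_ , eq) → to eq (rankCase S⊆E)) back
      where
      x≤ = L.rank-mono (X∪g⊆E S⊆E) id
      y≤ = M.rank-mono (Y∪g⊆E S⊆E) id

      halves : N.rank S ≡ N.rank N.E → suc (N.rank S) ≡ L.rank (X′ ∪ ⁅ g ⁆) + M.rank (Y′ ∪ ⁅ g ⁆) →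
        L.rank (X′ ∪ ⁅ g ⁆) ≡ L.rank L.E × M.rank (Y′ ∪ ⁅ g ⁆) ≡ M.rank M.E
      halves eq r = +-≡-split x≤ y≤ (trans (sym r) (trans (cong suc eq) rank-E))

      whole : L.rank (X′ ∪ ⁅ g ⁆) ≡ L.rank L.E → M.rank (Y′ ∪ ⁅ g ⁆) ≡ M.rank M.E →
        suc (N.rank S) ≡ L.rank (X′ ∪ ⁅ g ⁆) + M.rank (Y′ ∪ ⁅ g ⁆) → N.rank S ≡ N.rank N.E
      whole x y r = ℕₚ.suc-injective (trans r (trans (cong₂ _+_ x y) (sym rank-E)))

      rank-cc : ∀ {x x′ y y′ m} → x′ ≡ x → y′ ≡ y → suc m ≡ x + y → suc m ≡ x′ + y′
      rank-cc refl refl r = r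
      rank-co : ∀ {x x′ y y′ m} → x′ ≡ x → y′ ≡ suc y → m ≡ x + y → suc m ≡ x′ + y′
      rank-co refl refl refl = sym (ℕₚ.+-suc _ _)
      rank-oc : ∀ {x x′ y y′ m} → x′ ≡ suc x → y′ ≡ y → m ≡ x + y → suc m ≡ x′ + y′
      rank-oc refl refl refl = refl

      to : N.rank S ≡ N.rank N.E → RankCase S⊆E →
        L.Spanning (X′ ∪ ⁅ g ⁆) × M.Spanning (Y′ ∪ ⁅ g ⁆) × (L.Spanning X′ ⊎ M.Spanning Y′)
      to eq (cc p q r) = let (x , y) = halves eq (rank-cc p q r) in (X∪g⊆E S⊆E , x) , (Y∪g⊆E S⊆E , y)
        , inj₁ (X⊆E S⊆E , trans (sym p) x)
      to eq (co p q r) = let (x , y) = halves eq (rank-co p q r) in (X∪g⊆E S⊆E , x) , (Y∪g⊆E S⊆E , y)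
        , inj₁ (X⊆E S⊆E , trans (sym p) x)
      to eq (oc p q r) = let (x , y) = halves eq (rank-oc p q r) in (X∪g⊆E S⊆E , x) , (Y∪g⊆E S⊆E , y)
        , inj₂ (Y⊆E S⊆E , trans (sym q) y)
      -- Here both ranks grow by one, so their sum would exceed `L.rank L.E + M.rank M.E`.
      to eq (oo p q r) = contradiction (ℕₚ.+-mono-≤ x≤ y≤) (ℕₚ.<⇒≱ (begin-strict
        L.rank L.E + M.rank M.E                        ≡⟨ rank-E ⟨
        suc (N.rank N.E)                               ≡⟨ cong suc eq ⟨
        suc (N.rank S)                                 ≡⟨ cong suc r ⟩
        suc (L.rank X′) + M.rank Y′
          <⟨ ℕₚ.+-monoʳ-< (suc (L.rank X′)) (ℕₚ.n<1+n (M.rank Y′)) ⟩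
        suc (L.rank X′) + suc (M.rank Y′)              ≡⟨ cong₂ _+_ p q ⟨
        L.rank (X′ ∪ ⁅ g ⁆) + M.rank (Y′ ∪ ⁅ g ⁆) ∎))
        where open ℕₚ.≤-Reasoning

      from : L.Spanning (X′ ∪ ⁅ g ⁆) × M.Spanning (Y′ ∪ ⁅ g ⁆) × (L.Spanning X′ ⊎ M.Spanning Y′) →
        RankCase S⊆E → N.rank S ≡ N.rank N.E
      from ((_ , x) , (_ , y) , _) (cc p q r) = whole x y (rank-cc p q r)
      from ((_ , x) , (_ , y) , _) (co p q r) = whole x y (rank-co p q r)
      from ((_ , x) , (_ , y) , _) (oc p q r) = whole x y (rank-oc p q r)
      from ((_ , x) , _ , inj₁ (_ , x₀)) (oo p q r) =
        contradiction (trans (sym p) (trans x (sym x₀))) ℕₚ.1+n≢n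
      from (_ , (_ , y) , inj₂ (_ , y₀)) (oo p q r) =
        contradiction (trans (sym q) (trans y (sym y₀))) ℕₚ.1+n≢n

      back : L.Spanning (X′ ∪ ⁅ g ⁆) × M.Spanning (Y′ ∪ ⁅ g ⁆) × (L.Spanning X′ ⊎ M.Spanning Y′) →
        N.Spanning S
      back p = S⊆E , from p (rankCase S⊆E)

    basis⇔ : N.Basis S ⇔
      ((L.Basis (X′ ∪ ⁅ g ⁆) × M.Basis Y′) ⊎ (L.Basis X′ × M.Basis (Y′ ∪ ⁅ g ⁆)))
    basis⇔ = mk⇔
      (λ (i , s) → to (Equivalence.to (independent⇔ S⊆E) i) (Equivalence.to spanning⇔ s))
      (λ p → Equivalence.from (independent⇔ S⊆E) (fromᵢ p) , Equivalence.from spanning⇔ (fromₛ p))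
      where
      to : L.Independent X′ × M.Independent Y′ ×
        (L.Independent (X′ ∪ ⁅ g ⁆) ⊎ M.Independent (Y′ ∪ ⁅ g ⁆)) →
        L.Spanning (X′ ∪ ⁅ g ⁆) × M.Spanning (Y′ ∪ ⁅ g ⁆) × (L.Spanning X′ ⊎ M.Spanning Y′) →
        (L.Basis (X′ ∪ ⁅ g ⁆) × M.Basis Y′) ⊎ (L.Basis X′ × M.Basis (Y′ ∪ ⁅ g ⁆))
      to (i , j , inj₁ i′) (s′ , t′ , inj₂ t) = inj₁ ((i′ , s′) , (j , t))
      to (i , j , inj₂ j′) (s′ , t′ , inj₁ s) = inj₂ ((i , s) , (j′ , t′))
      to (i , j , inj₁ i′) (s′ , t′ , inj₁ s) = contradiction i′ (LP.independent-spanning (g∉X S⊆E) s)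
      to (i , j , inj₂ j′) (s′ , t′ , inj₂ t) = contradiction j′ (MP.independent-spanning (g∉Y S⊆E) t)

      fromᵢ : (L.Basis (X′ ∪ ⁅ g ⁆) × M.Basis Y′) ⊎ (L.Basis X′ × M.Basis (Y′ ∪ ⁅ g ⁆)) →
        L.Independent X′ × M.Independent Y′ × (L.Independent (X′ ∪ ⁅ g ⁆) ⊎ M.Independent (Y′ ∪ ⁅ g ⁆))
      fromᵢ (inj₁ ((i′ , _) , (j , _))) = LP.independent-⊆ (X⊆E S⊆E) (g∉X S⊆E) i′ , j , inj₁ i′
      fromᵢ (inj₂ ((i , _) , (j′ , _))) = i , MP.independent-⊆ (Y⊆E S⊆E) (g∉Y S⊆E) j′ , inj₂ j′

      fromₛ : (L.Basis (X′ ∪ ⁅ g ⁆) × M.Basis Y′) ⊎ (L.Basis X′ × M.Basis (Y′ ∪ ⁅ g ⁆)) →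
        L.Spanning (X′ ∪ ⁅ g ⁆) × M.Spanning (Y′ ∪ ⁅ g ⁆) × (L.Spanning X′ ⊎ M.Spanning Y′)
      fromₛ (inj₁ ((_ , s′) , (_ , t))) = s′ , MP.spanning-⊆ (p⊆p∪q ⁅ g ⁆) (Y∪g⊆E S⊆E) t , inj₂ t
      fromₛ (inj₂ ((_ , s) , (_ , t′))) = LP.spanning-⊆ (p⊆p∪q ⁅ g ⁆) (X∪g⊆E S⊆E) s , t′ , inj₁ s

-- The coefficient pair (m , n) stands for the integer m − n.  Pairs are kept
-- reduced because the solver compares normal forms syntactically.
module DifferenceSolver {c ℓ} (R : CommutativeRing c ℓ) where
  open CommutativeRing R
  open import Algebra.Properties.Ring ring
  open import Algebra.Properties.Semiring.Mult semiring
    renaming (_×_ to _·_)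
  open import Relation.Binary.Reasoning.Setoid setoid
  import Algebra.Solver.Ring.NaturalCoefficients.Default commutativeSemiring as S

  private
    reduce : ℕ × ℕ → ℕ × ℕ
    reduce (m , n) = (m ℕ.∸ n , n ℕ.∸ m)

    Difference : RawRing _ _
    Difference = record
      { Carrier = ℕ × ℕ
      ; _≈_     = _≡_
      ; _+_     = λ (m , n) (p , q) → reduce (m ℕ.+ p , n ℕ.+ q)
      ; _*_     = λ (m , n) (p , q) → reduce (m ℕ.* p ℕ.+ n ℕ.* q , m ℕ.* q ℕ.+ n ℕ.* p)
      ; -_      = λ (m , n) → (n , m)
      ; 0#      = (0 , 0)
      ; 1#      = (1 , 0)
      }

    ⟦_⟧ : ℕ × ℕ → Carrier
    ⟦ m , n ⟧ = m · 1# - n · 1#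

    -- Equality of formal differences becomes an equation free of negatives, so it can be
    -- transported from the natural numbers.
    move : ∀ {a b c d} → a + d ≈ c + b → a - b ≈ c - d
    move {a} {b} {c} {d} eq = begin
      a - b                 ≈⟨ +-identityʳ _ ⟨
      a - b + 0#            ≈⟨ +-congˡ (-‿inverseʳ d) ⟨
      a - b + (d - d)       ≈⟨ S.solve 4 (λ a b′ d d′ → (a S.:+ b′) S.:+ (d S.:+ d′) S.:=
                                 (a S.:+ d) S.:+ (b′ S.:+ d′)) refl
                                 a (- b) d (- d) ⟩
      a + d + (- b - d)     ≈⟨ +-congʳ eq ⟩
      c + b + (- b - d)     ≈⟨ S.solve 4 (λ c b b′ d′ → (c S.:+ b) S.:+ (b′ S.:+ d′) S.:=
                                 (c S.:+ d′) S.:+ (b S.:+ b′)) refl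
                                 c b (- b) (- d) ⟩
      c - d + (b - b)       ≈⟨ +-congˡ (-‿inverseʳ b) ⟩
      c - d + 0#            ≈⟨ +-identityʳ _ ⟩
      c - d ∎

    ∸-balance : ∀ m n → (m ℕ.∸ n) ℕ.+ n ≡ m ℕ.+ (n ℕ.∸ m)
    ∸-balance zero    zero    = ≡.refl
    ∸-balance zero    (suc n) = ≡.refl
    ∸-balance (suc m) zero    = ≡.refl
    ∸-balance (suc m) (suc n) = ≡.trans (ℕₚ.+-suc (m ℕ.∸ n) n) (≡.cong suc (∸-balance m n))

    ⟦⟧-cong : ∀ m n p q → m ℕ.+ q ≡ p ℕ.+ n → ⟦ m , n ⟧ ≈ ⟦ p , q ⟧
    ⟦⟧-cong m n p q e = move (begin
      m · 1# + q · 1#   ≈⟨ ×-homo-+ 1# m q ⟨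
      (m ℕ.+ q) · 1#    ≡⟨ ≡.cong (_· 1#) e ⟩
      (p ℕ.+ n) · 1#    ≈⟨ ×-homo-+ 1# p n ⟩
      p · 1# + n · 1# ∎)

    ⟦reduce⟧ : ∀ m n → ⟦ reduce (m , n) ⟧ ≈ ⟦ m , n ⟧
    ⟦reduce⟧ m n = ⟦⟧-cong (m ℕ.∸ n) (n ℕ.∸ m) m n (∸-balance m n)

    split : ∀ a b c d → (a - b) + (c - d) ≈ (a + c) - (b + d)
    split a b c d = begin
      (a - b) + (c - d)     ≈⟨ S.solve 4 (λ a b c d → (a S.:+ b) S.:+ (c S.:+ d) S.:=
                                 (a S.:+ c) S.:+ (b S.:+ d)) refl
                                 a (- b) c (- d) ⟩
      (a + c) + (- b - d)   ≈⟨ +-congˡ (-‿+-comm b d) ⟩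
      (a + c) - (b + d) ∎

    -x*-y≈x*y : ∀ x y → - x * - y ≈ x * y
    -x*-y≈x*y x y = begin
      - x * - y      ≈⟨ -‿distribˡ-* x (- y) ⟨
      - (x * - y)    ≈⟨ -‿cong (-‿distribʳ-* x y) ⟨
      - - (x * y)    ≈⟨ -‿involutive _ ⟩
      x * y ∎

    homo-* : ∀ a b c d → (a * c + b * d) - (a * d + b * c) ≈ (a - b) * (c - d)
    homo-* a b c d = sym (begin
      (a - b) * (c - d)
        ≈⟨ distribˡ _ _ _ ⟩
      (a - b) * c + (a - b) * - d
        ≈⟨ +-cong (distribʳ _ _ _) (distribʳ _ _ _) ⟩
      (a * c + - b * c) + (a * - d + - b * - d)
        ≈⟨ +-cong (+-congˡ (sym (-‿distribˡ-* b c)))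
                  (+-cong (sym (-‿distribʳ-* a d)) (-x*-y≈x*y b d)) ⟩
      (a * c - b * c) + (- (a * d) + b * d)
        ≈⟨ +-congˡ (+-comm _ _) ⟩
      (a * c - b * c) + (b * d - a * d)
        ≈⟨ split _ _ _ _ ⟩
      (a * c + b * d) - (b * c + a * d)
        ≈⟨ +-congˡ (-‿cong (+-comm _ _)) ⟩
      (a * c + b * d) - (a * d + b * c) ∎)

    ·-homo : ∀ m n p q → (m ℕ.* p ℕ.+ n ℕ.* q) · 1# ≈ m · 1# * p · 1# + n · 1# * q · 1#
    ·-homo m n p q = trans (×-homo-+ 1# (m ℕ.* p) (n ℕ.* q)) (+-cong (×1-homo-* m p) (×1-homo-* n q))

    morphism : Difference -Raw-AlmostCommutative⟶ fromCommutativeRing R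
    morphism = record
      { ⟦_⟧    = ⟦_⟧
      ; +-homo = λ (m , n) (p , q) → trans (⟦reduce⟧ (m ℕ.+ p) (n ℕ.+ q)) (trans
          (+-cong (×-homo-+ 1# m p) (-‿cong (×-homo-+ 1# n q)))
          (sym (split _ _ _ _)))
      ; *-homo = λ (m , n) (p , q) → trans (⟦reduce⟧ (m ℕ.* p ℕ.+ n ℕ.* q) _) (trans
          (+-cong (·-homo m n p q) (-‿cong (·-homo m n q p)))
          (homo-* _ _ _ _))
      ; -‿homo = λ (m , n) → trans (+-comm _ _)
          (trans (+-congˡ (sym (-‿involutive _))) (-‿+-comm _ _))
      ; 0-homo = -‿inverseʳ 0#
      ; 1-homo = trans (+-cong (+-identityʳ 1#) -0#≈0#) (+-identityʳ 1#)
      }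

    _coeff≟_ : ∀ x y → Maybe (⟦ x ⟧ ≈ ⟦ y ⟧)
    (m , n) coeff≟ (p , q) with m ℕ.+ q ℕₚ.≟ p ℕ.+ n
    ... | no _   = nothing
    ... | yes eq = just (⟦⟧-cong m n p q eq)

  open RingSolver Difference (fromCommutativeRing R) morphism _coeff≟_ public
    using (solve; _:=_; _:+_; _:*_; _:-_; :-_)

module _ {c ℓ₁ ℓ₂} (ℝ : RealField c ℓ₁ ℓ₂) where
  open RealField ℝ
  open CommutativeRing commutativeRing
    hiding (zero; Carrier; _≈_; _+_; _*_; -_; _-_; 0#; 1#)
  open import Algebra.Properties.Ring ring
  open import Algebra.Properties.Semiring.Exp semiring using (^-homo-*)
  open DifferenceSolver commutativeRing

  -- Ordered field arithmetic

  <-resp : ∀ {x y u v} → x ≈ u → y ≈ v → x < y → u < v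
  <-resp x≈u y≈v x<y = IsStrictPartialOrder.<-respʳ-≈ isStrictPartialOrder y≈v
    (IsStrictPartialOrder.<-respˡ-≈ isStrictPartialOrder x≈u x<y)

  <-trans : ∀ {x y z} → x < y → y < z → x < z
  <-trans = IsStrictPartialOrder.trans isStrictPartialOrder

  <-asym : ∀ {x y} → x < y → ¬ (y < x)
  <-asym = IsStrictPartialOrder.asym isStrictPartialOrder

  <-irrefl : ∀ {x y} → x ≈ y → ¬ (x < y)
  <-irrefl = IsStrictPartialOrder.irrefl isStrictPartialOrder

  #⇒<⊎> : ∀ {x y} → x # y → x < y ⊎ y < x
  #⇒<⊎> {x} {y} = Equivalence.to (#⇔<⊎> x y)

  <⇒# : ∀ {x y} → x < y → x # y
  <⇒# {x} {y} x<y = Equivalence.from (#⇔<⊎> x y) (inj₁ x<y)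

  >⇒# : ∀ {x y} → y < x → x # y
  >⇒# {x} {y} y<x = Equivalence.from (#⇔<⊎> x y) (inj₂ y<x)

  ≤-resp : ∀ {x y u v} → x ≈ u → y ≈ v → x ≤ y → u ≤ v
  ≤-resp x≈u y≈v x≤y v<u = x≤y (<-resp (sym y≈v) (sym x≈u) v<u)

  <⇒≤ : ∀ {x y} → x < y → x ≤ y
  <⇒≤ = <-asym

  x-0≈x : ∀ x → x - 0# ≈ x
  x-0≈x x = trans (+-congˡ -0#≈0#) (+-identityʳ x)

  +-pos : ∀ {x y} → 0# < x → 0# < y → 0# < x + y
  +-pos {x} {y} 0<x 0<y = <-trans 0<y (<-resp (+-identityˡ y) refl (+-monoˡ-< y 0<x))

  x<y⇒0<y-x : ∀ {x y} → x < y → 0# < y - x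
  x<y⇒0<y-x {x} x<y = <-resp (-‿inverseʳ x) refl (+-monoˡ-< (- x) x<y)

  0<y-x⇒x<y : ∀ {x y} → 0# < y - x → x < y
  0<y-x⇒x<y {x} {y} p = <-resp (+-identityˡ x)
    (solve 2 (λ x y → (y :- x) :+ x := y) refl x y) (+-monoˡ-< x p)

  x<0⇒0<-x : ∀ {x} → x < 0# → 0# < - x
  x<0⇒0<-x x<0 = <-resp refl (+-identityˡ _) (x<y⇒0<y-x x<0)

  0<-x⇒x<0 : ∀ {x} → 0# < - x → x < 0#
  0<-x⇒x<0 0<-x = 0<y-x⇒x<y (<-resp refl (sym (+-identityˡ _)) 0<-x)

  *-pos-neg : ∀ {x y} → 0# < x → y < 0# → x * y < 0#
  *-pos-neg 0<x y<0 = 0<-x⇒x<0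
    (<-resp refl (sym (-‿distribʳ-* _ _)) (*-pos 0<x (x<0⇒0<-x y<0)))

  invertible⇒#0 : ∀ {x y} → y * x ≈ 1# → x # 0#
  invertible⇒#0 {x} {y} yx≈1 = HeytingField.invertible⇒# heytingField
    (y , trans (*-congˡ (x-0≈x x)) yx≈1 , trans (*-comm _ _) (trans (*-congˡ (x-0≈x x)) yx≈1))

  -- Invertibility yields only that 1 is apart from 0; a negative 1 is excluded because 1 is the
  -- square of -1.
  0<1 : 0# < 1#
  0<1 with #⇒<⊎> (invertible⇒#0 {1#} {1#} (*-identityˡ 1#))
  ... | inj₂ p = p
  ... | inj₁ 1<0 = ⊥-elim (<-asym 1<0 (<-resp refl
          (trans (solve 1 (λ x → :- x :* :- x := x :* x) refl 1#) (*-identityˡ 1#))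
          (*-pos (x<0⇒0<-x 1<0) (x<0⇒0<-x 1<0))))

  #0-factorˡ : ∀ {x y} → x * y # 0# → x # 0#
  #0-factorˡ {x} {y} xy#0 with HeytingField.#⇒invertible heytingField xy#0
  ... | z , zxy≈1 , _ = invertible⇒#0 {y = z * y} (trans
          (trans (solve 3 (λ x y z → (z :* y) :* x := z :* (x :* y)) refl x y z)
            (*-congˡ (sym (x-0≈x (x * y))))) zxy≈1)

  -- The signs of `x` and `y` cannot be decided outright. Under the assumption `x * y < 0#`, which
  -- is to be refuted, both factors are apart from 0, and their signs become available.
  *-nonneg : ∀ {x y} → 0# ≤ x → 0# ≤ y → 0# ≤ x * y
  *-nonneg {x} {y} 0≤x 0≤y xy<0 = [ 0≤x , (λ 0<x → [ 0≤y , (λ 0<y →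
    <-asym xy<0 (*-pos 0<x 0<y)) ]′ (#⇒<⊎> y#0)) ]′ (#⇒<⊎> x#0)
    where
    x#0 = #0-factorˡ (<⇒# xy<0)
    y#0 = #0-factorˡ (<⇒# (<-resp (*-comm x y) refl xy<0))

  ⁻¹-inverseˡ : ∀ {x} (0<x : 0# < x) → (x ⁻¹[ 0<x ]) * x ≈ 1#
  ⁻¹-inverseˡ {x} 0<x = trans (*-congˡ (sym (x-0≈x x)))
    (proj₁ (proj₂ (#⇒invertible {x} {0#} (>⇒# 0<x))))

  ⁻¹-pos : ∀ {x} (0<x : 0# < x) → 0# < x ⁻¹[ 0<x ]
  ⁻¹-pos {x} 0<x with #⇒<⊎> (invertible⇒#0 {x ⁻¹[ 0<x ]} {x} (trans (*-comm _ _) (⁻¹-inverseˡ 0<x)))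
  ... | inj₂ p = p
  ... | inj₁ p = ⊥-elim (<-asym 0<1
          (<-resp (trans (*-comm _ _) (⁻¹-inverseˡ 0<x)) refl (*-pos-neg 0<x p)))

  ^-pos : ∀ {x} k → 0# < x → 0# < x ^ k
  ^-pos zero    0<x = 0<1
  ^-pos (suc k) 0<x = *-pos 0<x (^-pos k 0<x)

  -- Cotransitivity makes `x` apart from `y` or from `z`, and either apartness gives a comparison
  -- that settles the claim.
  ≤-<-trans : ∀ {x y z} → x ≤ y → y < z → x < z
  ≤-<-trans {x} {y} {z} x≤y y<z with #-cotrans (<⇒# y<z) x
  ... | inj₁ y#x with #⇒<⊎> y#x
  ...   | inj₁ y<x = ⊥-elim (x≤y y<x)
  ...   | inj₂ x<y = <-trans x<y y<z
  ≤-<-trans {x} {y} {z} x≤y y<z | inj₂ x#z with #⇒<⊎> x#z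
  ...   | inj₁ x<z = x<z
  ...   | inj₂ z<x = ⊥-elim (x≤y (<-trans y<z z<x))

  -- Half the harmonic mean x y / (x + y) lies below x and y.
  lowerBound : ∀ {x y} → 0# < x → 0# < y → ∃[ z ] (0# < z × z < x × z < y)
  lowerBound {x} {y} 0<x 0<y = (s * x * y) , *-pos (*-pos 0<s 0<x) 0<y
    , 0<y-x⇒x<y (<-resp refl eqˣ (*-pos (*-pos 0<s 0<x) 0<x))
    , 0<y-x⇒x<y (<-resp refl eqʸ (*-pos (*-pos 0<s 0<y) 0<y))
    where
    0<x+y = +-pos 0<x 0<y
    s = (x + y) ⁻¹[ 0<x+y ]
    0<s = ⁻¹-pos 0<x+y
    unit : ∀ z → s * (x + y) * z ≈ z
    unit z = trans (*-congʳ (⁻¹-inverseˡ 0<x+y)) (*-identityˡ z)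
    eqˣ : s * x * x ≈ x - s * x * y
    eqˣ = trans (solve 3 (λ s x y → s :* x :* x := s :* (x :+ y) :* x :- s :* x :* y) refl s x y)
                (+-congʳ (unit x))
    eqʸ : s * y * y ≈ y - s * x * y
    eqʸ = trans (solve 3 (λ s x y → s :* y :* y := s :* (x :+ y) :* y :- s :* x :* y) refl s x y)
                (+-congʳ (unit y))

  -- Constructively stronger than `0# ≤ x`, since it records which alternative holds. The
  -- coefficients below meet it because they come from decided predicates or from ranks, and it
  -- reduces positivity of sums to case distinctions.
  data NonNegative (x : Carrier) : Set (ℓ₁ ⊔ ℓ₂) where
    null : x ≈ 0# → NonNegative x
    pos  : 0# < x → NonNegative x

  NonNegative-resp : ∀ {x y} → x ≈ y → NonNegative x → NonNegative y
  NonNegative-resp x≈y (null x≈0) = null (trans (sym x≈y) x≈0)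
  NonNegative-resp x≈y (pos 0<x)  = pos (<-resp refl x≈y 0<x)

  NonNegative⇒≤ : ∀ {x} → NonNegative x → 0# ≤ x
  NonNegative⇒≤ (null x≈0) x<0 = <-irrefl x≈0 x<0
  NonNegative⇒≤ (pos 0<x)      = <⇒≤ 0<x

  pos+nonneg : ∀ {x y} → 0# < x → NonNegative y → 0# < x + y
  pos+nonneg 0<x (null y≈0) = <-resp refl (trans (sym (+-identityʳ _)) (+-congˡ (sym y≈0))) 0<x
  pos+nonneg 0<x (pos 0<y)  = +-pos 0<x 0<y

  +-nonneg : ∀ {x y} → NonNegative x → NonNegative y → NonNegative (x + y)
  +-nonneg (null x≈0) q = NonNegative-resp (trans (sym (+-identityˡ _)) (+-congʳ (sym x≈0))) q
  +-nonneg (pos 0<x)  q = pos (pos+nonneg 0<x q)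

  nonneg*pos : ∀ {x y} → NonNegative x → 0# < y → NonNegative (x * y)
  nonneg*pos (null x≈0) 0<y = null (trans (*-congʳ x≈0) (zeroˡ _))
  nonneg*pos (pos 0<x)  0<y = pos (*-pos 0<x 0<y)

  -- Polynomials and partial derivatives

  private
    Poly = MultiaffinePoly ℝ
    sum : (E : Subset n) → (Subset n → Carrier) → Carrier
    sum = sumSubsets ℝ

  sum-cong : {E : Subset n} {f f′ : Subset n → Carrier} →
    (∀ S → S ⊆ E → f S ≈ f′ S) → sum E f ≈ sum E f′
  sum-cong {E = []}          eq = eq [] λ ()
  sum-cong {E = inside ∷ E}  eq = +-cong
    (sum-cong λ S S⊆E → eq (inside ∷ S) (s⊆s S⊆E))
    (sum-cong λ S S⊆E → eq (outside ∷ S) (out⊆ S⊆E))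
  sum-cong {E = outside ∷ E} eq = sum-cong λ S S⊆E → eq (outside ∷ S) (out⊆ S⊆E)

  sum-+ : (E : Subset n) (f f′ : Subset n → Carrier) →
    sum E (λ S → f S + f′ S) ≈ sum E f + sum E f′
  sum-+ []            f f′ = refl
  sum-+ (outside ∷ E) f f′ = sum-+ E _ _
  sum-+ (inside  ∷ E) f f′ = trans (+-cong (sum-+ E _ _) (sum-+ E _ _))
    (solve 4 (λ a b c d → (a :+ b) :+ (c :+ d) := (a :+ c) :+ (b :+ d)) refl _ _ _ _)

  sum-* : (E : Subset n) (k : Carrier) (f : Subset n → Carrier) →
    sum E (λ S → k * f S) ≈ k * sum E f
  sum-* []            k f = refl
  sum-* (outside ∷ E) k f = sum-* E k _
  sum-* (inside  ∷ E) k f = trans (+-cong (sum-* E k _) (sum-* E k _)) (sym (distribˡ k _ _))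

  sum-product : {A B : Subset n} → Disjoint A B → (f f′ : Subset n → Carrier) →
    sum (A ∪ B) (λ S → f (S ∩ A) * f′ (S ∩ B)) ≈ sum A f * sum B f′
  sum-product {A = []} {[]} dis f f′ = refl
  sum-product {A = inside ∷ A} {inside ∷ B} dis f f′ = contradiction here (dis here)
  sum-product {A = inside ∷ A} {outside ∷ B} dis f f′ = trans
    (+-cong (sum-product (drop-∷-disjoint dis) _ _)
            (sum-product (drop-∷-disjoint dis) _ _))
    (sym (distribʳ _ _ _))
  sum-product {A = outside ∷ A} {inside ∷ B} dis f f′ = trans
    (+-cong (sum-product (drop-∷-disjoint dis) _ _)
            (sum-product (drop-∷-disjoint dis) _ _))
    (sym (distribˡ _ _ _))
  sum-product {A = outside ∷ A} {outside ∷ B} dis f f′ =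
    sum-product (drop-∷-disjoint dis) _ _

  sum-peel : {E : Subset n} {g : Fin n} → g ∈ E → (f : Subset n → Carrier) →
    sum E f ≈ sum (E ∖ g) f + sum (E ∖ g) (λ S → f (S ∪ ⁅ g ⁆))
  -- `sumSubsets` lists the sets containing the first element first, hence the commutation. Removing
  -- or adjoining `zero` leaves a difference or a union with the empty set in the tail.
  sum-peel {E = inside ∷ E} {zero} here f = trans (+-comm _ _) (+-cong
    (reflexive (≡.cong (λ D → sum D (f ∘ (outside ∷_))) (≡.sym (p─⊥≡p E))))
    (trans
      (sum-cong {E = E} λ S _ → reflexive (≡.cong (f ∘ (inside ∷_)) (≡.sym (∪-identityʳ S))))
      (reflexive (≡.cong (λ D → sum D (λ S → f (inside ∷ (S ∪ _)))) (≡.sym (p─⊥≡p E))))))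
  sum-peel {E = inside ∷ E} {suc g} (there g∈E) f = trans
    (+-cong (sum-peel g∈E (f ∘ (inside ∷_))) (sum-peel g∈E (f ∘ (outside ∷_))))
    (solve 4 (λ a b c d → (a :+ b) :+ (c :+ d) := (a :+ c) :+ (b :+ d)) refl _ _ _ _)
  sum-peel {E = outside ∷ E} {suc g} (there g∈E) f = sum-peel g∈E (f ∘ (outside ∷_))

  sum-nonneg : {E : Subset n} {f : Subset n → Carrier} →
    (∀ S → S ⊆ E → NonNegative (f S)) → NonNegative (sum E f)
  sum-nonneg {E = []}          nn = nn [] λ ()
  sum-nonneg {E = inside ∷ E}  nn = +-nonneg
    (sum-nonneg λ S S⊆E → nn (inside ∷ S) (s⊆s S⊆E))
    (sum-nonneg λ S S⊆E → nn (outside ∷ S) (out⊆ S⊆E))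
  sum-nonneg {E = outside ∷ E} nn = sum-nonneg λ S S⊆E → nn (outside ∷ S) (out⊆ S⊆E)

  sum-pos : {E : Subset n} {f : Subset n → Carrier} →
    (∀ S → S ⊆ E → NonNegative (f S)) → ∀ S → S ⊆ E → 0# < f S → 0# < sum E f
  sum-pos {E = []}          nn [] S⊆E 0<fS = 0<fS
  sum-pos {E = inside ∷ E}  nn (inside ∷ S) S⊆E 0<fS = pos+nonneg
    (sum-pos (λ T T⊆E → nn (inside ∷ T) (s⊆s T⊆E)) S (drop-∷-⊆ S⊆E) 0<fS)
    (sum-nonneg λ T T⊆E → nn (outside ∷ T) (out⊆ T⊆E))
  sum-pos {E = inside ∷ E}  nn (outside ∷ S) S⊆E 0<fS = <-resp refl (+-comm _ _) (pos+nonneg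
    (sum-pos (λ T T⊆E → nn (outside ∷ T) (out⊆ T⊆E)) S (drop-∷-⊆ S⊆E) 0<fS)
    (sum-nonneg λ T T⊆E → nn (inside ∷ T) (s⊆s T⊆E)))
  sum-pos {E = outside ∷ E} nn (inside ∷ S) S⊆E 0<fS with S⊆E here
  ... | ()
  sum-pos {E = outside ∷ E} nn (outside ∷ S) S⊆E 0<fS =
    sum-pos (λ T T⊆E → nn (outside ∷ T) (out⊆ T⊆E)) S (drop-∷-⊆ S⊆E) 0<fS

  mono : Subset n → (Fin n → Carrier) → Carrier
  mono = monomial ℝ

  mono-cong : (S : Subset n) {y y′ : Fin n → Carrier} →
    (∀ i → i ∈ S → y i ≈ y′ i) → mono S y ≈ mono S y′
  mono-cong []            eq = refl
  mono-cong (inside  ∷ S) eq = *-cong (eq zero here) (mono-cong S λ i i∈S → eq (suc i) (there i∈S))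
  mono-cong (outside ∷ S) eq = mono-cong S λ i i∈S → eq (suc i) (there i∈S)

  mono-pos : (S : Subset n) {y : Fin n → Carrier} → (∀ i → i ∈ S → 0# < y i) → 0# < mono S y
  mono-pos []            0<y = 0<1
  mono-pos (inside  ∷ S) 0<y = *-pos (0<y zero here) (mono-pos S λ i i∈S → 0<y (suc i) (there i∈S))
  mono-pos (outside ∷ S) 0<y = mono-pos S λ i i∈S → 0<y (suc i) (there i∈S)

  mono-∪⁅⁆ : {S : Subset n} {g : Fin n} → g ∉ S → (y : Fin n → Carrier) →
    mono (S ∪ ⁅ g ⁆) y ≈ y g * mono S y
  mono-∪⁅⁆ {S = inside  ∷ S} {zero}  g∉S y = contradiction here g∉S
  mono-∪⁅⁆ {S = outside ∷ S} {zero}  g∉S y rewrite ∪-identityʳ S = refl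
  mono-∪⁅⁆ {S = inside  ∷ S} {suc g} g∉S y = trans (*-congˡ (mono-∪⁅⁆ (g∉S ∘ there) (y ∘ suc)))
    (solve 3 (λ a b c → a :* (b :* c) := b :* (a :* c)) refl _ _ _)
  mono-∪⁅⁆ {S = outside ∷ S} {suc g} g∉S y = mono-∪⁅⁆ (g∉S ∘ there) (y ∘ suc)

  mono-split : {A B S : Subset n} → Disjoint A B → S ⊆ A ∪ B → (y : Fin n → Carrier) →
    mono S y ≈ mono (S ∩ A) y * mono (S ∩ B) y
  mono-split {A = []} {[]} {[]} dis S⊆ y = sym (*-identityˡ 1#)
  mono-split {A = a ∷ A} {b ∷ B} {outside ∷ S} dis S⊆ y =
    mono-split (drop-∷-disjoint dis) (drop-∷-⊆ S⊆) (y ∘ suc)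
  mono-split {A = inside ∷ A} {inside ∷ B} {inside ∷ S} dis S⊆ y = contradiction here (dis here)
  mono-split {A = inside ∷ A} {outside ∷ B} {inside ∷ S} dis S⊆ y = trans
    (*-congˡ (mono-split (drop-∷-disjoint dis) (drop-∷-⊆ S⊆) (y ∘ suc)))
    (sym (*-assoc _ _ _))
  mono-split {A = outside ∷ A} {inside ∷ B} {inside ∷ S} dis S⊆ y = trans
    (*-congˡ (mono-split (drop-∷-disjoint dis) (drop-∷-⊆ S⊆) (y ∘ suc)))
    (solve 3 (λ a b c → a :* (b :* c) := b :* (a :* c)) refl _ _ _)
  mono-split {A = outside ∷ A} {outside ∷ B} {inside ∷ S} dis S⊆ y with S⊆ here
  ... | ()

  ev : (E : Subset n) → Poly n → (Fin n → Carrier) → Carrier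
  ev = eval ℝ

  δ : Fin n → Poly n → Poly n
  δ = ∂ ℝ

  ev-cong : {E : Subset n} {Z Z′ : Poly n} {y y′ : Fin n → Carrier} →
    (∀ S → S ⊆ E → Z S ≈ Z′ S) → (∀ i → i ∈ E → y i ≈ y′ i) → ev E Z y ≈ ev E Z′ y′
  ev-cong Z≈ y≈ = sum-cong λ S S⊆E → *-cong (Z≈ S S⊆E) (mono-cong S λ i i∈S → y≈ i (S⊆E i∈S))

  ev-+ : (E : Subset n) (Z Z′ : Poly n) (y : Fin n → Carrier) →
    ev E (λ S → Z S + Z′ S) y ≈ ev E Z y + ev E Z′ y
  ev-+ E Z Z′ y = trans (sum-cong {E = E} λ S _ → distribʳ _ _ _) (sum-+ E _ _)

  ev-* : (E : Subset n) (k : Carrier) (Z : Poly n) (y : Fin n → Carrier) →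
    ev E (λ S → k * Z S) y ≈ k * ev E Z y
  ev-* E k Z y = trans (sum-cong {E = E} λ S _ → *-assoc _ _ _) (sum-* E k _)

  ev-0 : (E : Subset n) (y : Fin n → Carrier) → ev E (λ _ → 0#) y ≈ 0#
  ev-0 E y = trans (ev-cong {E = E} (λ _ _ → sym (zeroˡ 0#)) (λ _ _ → refl))
    (trans (ev-* E 0# (λ _ → 0#) y) (zeroˡ _))

  ev-- : (E : Subset n) (Z Z′ : Poly n) (y : Fin n → Carrier) →
    ev E (λ S → Z S - Z′ S) y ≈ ev E Z y - ev E Z′ y
  ev-- E Z Z′ y = trans (ev-+ E Z (λ S → - Z′ S) y) (+-congˡ (trans
    (ev-cong {E = E} (λ S _ → sym (-1*x≈-x _)) (λ _ _ → refl))
    (trans (ev-* E (- 1#) Z′ y) (-1*x≈-x _))))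

  ev-product : {A B : Subset n} → Disjoint A B → (a b : Poly n) (y : Fin n → Carrier) →
    ev (A ∪ B) (λ S → a (S ∩ A) * b (S ∩ B)) y ≈ ev A a y * ev B b y
  ev-product dis a b y = trans
    (sum-cong λ S S⊆ → trans (*-congˡ (mono-split dis S⊆ y))
      (solve 4 (λ a b c d → (a :* b) :* (c :* d) := (a :* c) :* (b :* d)) refl _ _ _ _))
    (sum-product dis _ _)

  δ-∈ : {S : Subset n} {e : Fin n} (Z : Poly n) → e ∈ S → δ e Z S ≈ 0#
  δ-∈ {S = S} {e} Z e∈S = reflexive (≡.cong (if_then 0# else Z (S ∪ ⁅ e ⁆)) (dec-true (e ∈? S) e∈S))

  δ-∉ : {S : Subset n} {e : Fin n} (Z : Poly n) → e ∉ S → δ e Z S ≈ Z (S ∪ ⁅ e ⁆)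
  δ-∉ {S = S} {e} Z e∉S = reflexive (≡.cong (if_then 0# else Z (S ∪ ⁅ e ⁆)) (dec-false (e ∈? S) e∉S))

  δ-cong : {E : Subset n} {e : Fin n} {Z Z′ : Poly n} → e ∈ E →
    (∀ S → S ⊆ E → Z S ≈ Z′ S) → ∀ S → S ⊆ E → δ e Z S ≈ δ e Z′ S
  δ-cong {e = e} {Z} {Z′} e∈E eq S S⊆E with e ∈? S
  ... | yes e∈S = refl
  ... | no  e∉S = eq _ (∪⊆ S⊆E (⁅⁆⊆ e∈E))

  δ-δ : (e : Fin n) (Z : Poly n) (S : Subset n) → δ e (δ e Z) S ≈ 0#
  δ-δ e Z S with e ∈? S
  ... | yes _ = refl
  ... | no  _ = δ-∈ Z (e∈S∪e S e)

  δ-comm : (e f : Fin n) (Z : Poly n) (S : Subset n) → δ e (δ f Z) S ≈ δ f (δ e Z) S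
  δ-comm e f Z S with e ≟ f
  ... | yes ≡.refl = refl
  ... | no  e≢f with e ∈? S | f ∈? S
  ...   | yes _   | yes _   = refl
  ...   | yes e∈S | no  _   = sym (δ-∈ Z (p⊆p∪q _ e∈S))
  ...   | no  _   | yes f∈S = δ-∈ Z (p⊆p∪q _ f∈S)
  ...   | no  e∉S | no  f∉S = trans (δ-∉ Z (∉∪⁅⁆ f∉S (e≢f ∘ ≡.sym))) (trans
    (reflexive (≡.cong Z (≡.trans (∪-assoc S _ _)
      (≡.trans (≡.cong (S ∪_) (∪-comm ⁅ e ⁆ ⁅ f ⁆)) (≡.sym (∪-assoc S _ _))))))
    (sym (δ-∉ Z (∉∪⁅⁆ e∉S e≢f))))

  ev-peel : {E : Subset n} {g : Fin n} → g ∈ E → (Z : Poly n) (y : Fin n → Carrier) →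
    ev E Z y ≈ ev (E ∖ g) Z y + y g * ev (E ∖ g) (δ g Z) y
  ev-peel {E = E} {g} g∈E Z y = trans (sum-peel g∈E _) (+-congˡ (trans
    (sum-cong λ S S⊆ → let g∉S = g∉p-g E g ∘ S⊆ in trans
      (*-cong (sym (δ-∉ Z g∉S)) (mono-∪⁅⁆ g∉S y))
      (solve 3 (λ a b c → a :* (b :* c) := b :* (a :* c)) refl _ _ _))
    (sum-* (E ∖ g) (y g) _)))

  ev-δ-peel : {E : Subset n} {g : Fin n} → g ∈ E → (Z : Poly n) (y : Fin n → Carrier) →
    ev E (δ g Z) y ≈ ev (E ∖ g) (δ g Z) y
  ev-δ-peel {E = E} {g} g∈E Z y = trans (ev-peel g∈E (δ g Z) y) (trans (+-congˡ (trans
    (*-congˡ (trans (ev-cong {E = E ∖ g} (λ S _ → δ-δ g Z S) (λ _ _ → refl)) (ev-0 (E ∖ g) y)))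
    (zeroʳ _))) (+-identityʳ _))

  Positive : Subset n → Poly n → Set (ℓ₁ ⊔ ℓ₂)
  Positive E Z = (∀ S → S ⊆ E → NonNegative (Z S)) × ∃[ S ] (S ⊆ E × 0# < Z S)

  ev-pos : {E : Subset n} {Z : Poly n} {y : Fin n → Carrier} →
    Positive E Z → (∀ i → i ∈ E → 0# < y i) → 0# < ev E Z y
  ev-pos (nn , S , S⊆E , 0<ZS) 0<y = sum-pos
    (λ T T⊆E → nonneg*pos (nn T T⊆E) (mono-pos T λ i → 0<y i ∘ T⊆E)) S S⊆E
    (*-pos 0<ZS (mono-pos S λ i → 0<y i ∘ S⊆E))

  -- Gluing two polynomials along g

  -- On each side the unprimed argument is the deletion of g and the primed
  -- one the contraction of g.
  bilinear : (k α β u u′ v v′ : Carrier) → Carrier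
  bilinear k α β u u′ v v′ = k * ((u * v′ + u′ * v) - (α * (u * v) + β * (u′ * v′)))

  bilinear-cong : ∀ {k α β u u′ v v′ x x′ z z′} → u ≈ x → u′ ≈ x′ → v ≈ z → v′ ≈ z′ →
    bilinear k α β u u′ v v′ ≈ bilinear k α β x x′ z z′
  bilinear-cong p p′ q q′ = *-congˡ (+-cong (+-cong (*-cong p q′) (*-cong p′ q))
    (-‿cong (+-cong (*-congˡ (*-cong p q)) (*-congˡ (*-cong p′ q′)))))

  bilinear-swap : ∀ k α β u u′ v v′ → bilinear k α β u u′ v v′ ≈ bilinear k α β v v′ u u′
  bilinear-swap = solve 7 (λ k α β u u′ v v′ →
    k :* ((u :* v′ :+ u′ :* v) :- (α :* (u :* v) :+ β :* (u′ :* v′))) :=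
    k :* ((v :* u′ :+ v′ :* u) :- (α :* (v :* u) :+ β :* (v′ :* u′)))) refl

  bilinear-zeroˡ : ∀ k α β v v′ → bilinear k α β 0# 0# v v′ ≈ 0#
  bilinear-zeroˡ k α β v v′ = trans
    -- `0#` enters the solver as the variable `o`, which factors out of the whole expression.
    (solve 6 (λ k α β o v v′ → k :* ((o :* v′ :+ o :* v) :- (α :* (o :* v) :+ β :* (o :* v′))) :=
      o :* (k :* ((v′ :+ v) :- (α :* v :+ β :* v′)))) refl k α β 0# v v′)
    (zeroˡ _)

  bilinear-collect : ∀ k α β u u′ v v′ →
    bilinear k α β u u′ v v′ ≈ k * ((v′ - α * v) * u + (v - β * v′) * u′)
  bilinear-collect = solve 7 (λ k α β u u′ v v′ →
    k :* ((u :* v′ :+ u′ :* v) :- (α :* (u :* v) :+ β :* (u′ :* v′))) :=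
    k :* ((v′ :- α :* v) :* u :+ (v :- β :* v′) :* u′)) refl

  -- The Cauchy–Binet formula: the Gram matrix has determinant αβ − 1.
  bilinear-det : ∀ k α β u u′ x x′ v v′ z z′ →
    bilinear k α β x x′ v v′ * bilinear k α β u u′ z z′ -
    bilinear k α β x x′ z z′ * bilinear k α β u u′ v v′ ≈
    (k * k) * ((1# - α * β) * ((x * u′ - x′ * u) * (z * v′ - z′ * v)))
  bilinear-det k α β u u′ x x′ v v′ z z′ = trans
    (solve 11 (λ k α β u u′ x x′ v v′ z z′ →
      (k :* ((x :* v′ :+ x′ :* v) :- (α :* (x :* v) :+ β :* (x′ :* v′)))) :*
      (k :* ((u :* z′ :+ u′ :* z) :- (α :* (u :* z) :+ β :* (u′ :* z′)))) :-
      (k :* ((x :* z′ :+ x′ :* z) :- (α :* (x :* z) :+ β :* (x′ :* z′)))) :*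
      (k :* ((u :* v′ :+ u′ :* v) :- (α :* (u :* v) :+ β :* (u′ :* v′)))) :=
      (k :* k) :* ((x :* u′ :- x′ :* u) :* (z :* v′ :- z′ :* v) :-
        (α :* β) :* ((x :* u′ :- x′ :* u) :* (z :* v′ :- z′ :* v))))
      refl k α β u u′ x x′ v v′ z z′)
    (*-congˡ (trans (+-congʳ (sym (*-identityˡ _)))
      (solve 3 (λ o p d → o :* d :- p :* d := (o :- p) :* d) refl 1# (α * β) _)))

  glue : (k α β : Carrier) (A B : Subset n) (a a′ b b′ : Poly n) → Poly n
  glue k α β A B a a′ b b′ S =
    bilinear k α β (a (S ∩ A)) (a′ (S ∩ A)) (b (S ∩ B)) (b′ (S ∩ B))

  module _ {k α β : Carrier} {A B : Subset n} (dis : Disjoint A B) where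

    -- Each of the four products pairs coefficients on disjoint sets of indeterminates, so it
    -- evaluates to a product of values, and evaluation is linear.
    ev-glue : (a a′ b b′ : Poly n) (y : Fin n → Carrier) →
      ev (A ∪ B) (glue k α β A B a a′ b b′) y ≈
      bilinear k α β (ev A a y) (ev A a′ y) (ev B b y) (ev B b′ y)
    ev-glue a a′ b b′ y = trans (ev-* E k _ y) (*-congˡ (trans (ev-- E _ _ y) (+-cong
      (trans (ev-+ E _ _ y) (+-cong (ev-product dis a b′ y) (ev-product dis a′ b y)))
      (-‿cong (trans (ev-+ E _ _ y) (+-cong
        (trans (ev-* E α _ y) (*-congˡ (ev-product dis a b y)))
        (trans (ev-* E β _ y) (*-congˡ (ev-product dis a′ b′ y)))))))))
      where E = A ∪ B

    -- Adjoining `e` changes `S ∩ A` only, so the derivative acts on the first pair alone; if `e` is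
    -- already in `S`, both sides vanish.
    δ-glue : {e : Fin n} → e ∈ A → (a a′ b b′ : Poly n) (S : Subset n) →
      δ e (glue k α β A B a a′ b b′) S ≈ glue k α β A B (δ e a) (δ e a′) b b′ S
    δ-glue {e} e∈A a a′ b b′ S with e ∈? S
    ... | yes e∈S = trans (sym (bilinear-zeroˡ k α β _ _)) (bilinear-cong
            (sym (δ-∈ a (x∈p∩q⁺ (e∈S , e∈A)))) (sym (δ-∈ a′ (x∈p∩q⁺ (e∈S , e∈A)))) refl refl)
    ... | no  e∉S = bilinear-cong
            (trans (reflexive (≡.cong a (∪⁅⁆-∩ e∈A))) (sym (δ-∉ a e∉S∩A)))
            (trans (reflexive (≡.cong a′ (∪⁅⁆-∩ e∈A))) (sym (δ-∉ a′ e∉S∩A)))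
            (reflexive (≡.cong b (∪⁅⁆-∩-∉ (dis e∈A))))
            (reflexive (≡.cong b′ (∪⁅⁆-∩-∉ (dis e∈A))))
      where e∉S∩A = e∉S ∘ p∩q⊆p S A

  glue-swap : (k α β : Carrier) (A B : Subset n) (a a′ b b′ : Poly n) (S : Subset n) →
    glue k α β A B a a′ b b′ S ≈ glue k α β B A b b′ a a′ S
  glue-swap k α β A B a a′ b b′ S = bilinear-swap k α β _ _ _ _

  Δ-comm : (E : Subset n) (Z : Poly n) (e f : Fin n) (y : Fin n → Carrier) →
    Δ ℝ E Z e f y ≈ Δ ℝ E Z f e y
  Δ-comm E Z e f y = +-cong (*-comm _ _)
    (-‿cong (*-congʳ (ev-cong {E = E} (λ S _ → δ-comm f e Z S) λ _ _ → refl)))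

  -- `contract` and `delete` make the weights u and v of the other side's polynomial positive at
  -- every positive point. They must be strictly positive: u is inverted, and v/u serves as a
  -- positive value for the indeterminate of `g`.
  record Side (α β : Carrier) (E : Subset n) (g : Fin n) (Z : Poly n) : Set (c ⊔ ℓ₁ ⊔ ℓ₂) where
    field
      g∈E      : g ∈ E
      rayleigh : Rayleigh ℝ E Z
      contract : Positive (E ∖ g) (λ S → Z (S ∪ ⁅ g ⁆) - α * Z S)
      delete   : Positive (E ∖ g) (λ S → Z S - β * Z (S ∪ ⁅ g ⁆))

    private
      A = E ∖ g

    A⊆E : A ⊆ E
    A⊆E = p─q⊆p E ⁅ g ⁆

    ∈A⇒≢g : ∀ {i} → i ∈ A → i ≢ g
    ∈A⇒≢g i∈A ≡.refl = g∉p-g E g i∈A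

    private
      module _ {y : Fin n → Carrier} (0<y : ∀ i → i ∈ A → 0# < y i) where

        -- The ground set of the two-sum omits `g`, so nothing is known about `y g`; a value there
        -- has to be supplied before the Rayleigh property of one side applies.
        _[g↦_] : Carrier → Fin n → Carrier
        _[g↦_] r i = if does (i ≟ g) then r else y i

        at-g : ∀ r → _[g↦_] r g ≈ r
        at-g r = reflexive (≡.cong (if_then r else y g) (dec-true (g ≟ g) ≡.refl))

        off-g : ∀ r i → i ∈ A → y i ≈ _[g↦_] r i
        off-g r i i∈A = reflexive (≡.cong (if_then r else y i)
          (≡.sym (dec-false (i ≟ g) (∈A⇒≢g i∈A))))

        update-pos : ∀ {r} → 0# < r → ∀ i → i ∈ E → 0# < _[g↦_] r i
        update-pos {r} 0<r i i∈E with i ≟ g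
        ... | yes _  = 0<r
        ... | no i≢g = 0<y i (x∈p∧x≢y⇒x∈p-y i∈E i≢g)

        ev-update : ∀ r h → ev E h (_[g↦_] r) ≈ ev A h y + r * ev A (δ g h) y
        ev-update r h = trans (ev-peel g∈E h _) (+-cong
          (ev-cong {E = A} (λ _ _ → refl) λ i → sym ∘ off-g r i)
          (*-cong (at-g r) (ev-cong {E = A} (λ _ _ → refl) λ i → sym ∘ off-g r i)))

    contract-pos : ∀ {y} → (∀ i → i ∈ A → 0# < y i) →
      0# < ev A (δ g Z) y - α * ev A Z y
    contract-pos {y} 0<y = <-resp refl
      (trans (ev-- A _ _ y) (+-cong
        (ev-cong {E = A} (λ S S⊆A → sym (δ-∉ Z (g∉p-g E g ∘ S⊆A))) λ _ _ → refl)
        (-‿cong (ev-* A α Z y))))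
      (ev-pos contract 0<y)

    delete-pos : ∀ {y} → (∀ i → i ∈ A → 0# < y i) →
      0# < ev A Z y - β * ev A (δ g Z) y
    delete-pos {y} 0<y = <-resp refl
      (trans (ev-- A _ _ y) (+-congˡ (-‿cong (trans (ev-* A β _ y) (*-congˡ
        (ev-cong {E = A} (λ S S⊆A → sym (δ-∉ Z (g∉p-g E g ∘ S⊆A))) λ _ _ → refl))))))
      (ev-pos delete 0<y)

    -- A form free of division: `X h` is `u` times the value of `h` where `g` is assigned w/u, and
    -- the expression is homogeneous of degree two in `X`.
    Δ-combination : ∀ {e f} → e ∈ A → f ∈ A → e ≢ f →
      ∀ {y} → (∀ i → i ∈ A → 0# < y i) → ∀ {u w} → 0# < u → 0# < w →
      let X = λ h → u * ev A h y + w * ev A (δ g h) y in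
      0# ≤ X (δ e Z) * X (δ f Z) - X (δ f (δ e Z)) * X Z
    Δ-combination {e} {f} e∈A f∈A e≢f {y} 0<y {u} {w} 0<u 0<w =
      ≤-resp refl eq (*-nonneg (<⇒≤ (*-pos 0<u 0<u))
        (Rayleigh.Δ≥0 rayleigh e f (A⊆E e∈A) (A⊆E f∈A) e≢f (_[g↦_] 0<y r) (update-pos 0<y 0<r)))
      where
      r = u ⁻¹[ 0<u ] * w
      0<r = *-pos (⁻¹-pos 0<u) 0<w
      X = λ h → u * ev A h y + w * ev A (δ g h) y
      scale : ∀ h → u * ev E h (_[g↦_] 0<y r) ≈ X h
      scale h = trans (*-congˡ (ev-update 0<y r h)) (trans
        (solve 5 (λ u v w a a′ → u :* (a :+ v :* w :* a′) := u :* a :+ v :* u :* (w :* a′))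
          refl u _ w _ _)
        (+-congˡ (trans (*-congʳ (⁻¹-inverseˡ 0<u)) (*-identityˡ _))))
      eq : (u * u) * Δ ℝ E Z e f (_[g↦_] 0<y r) ≈ X (δ e Z) * X (δ f Z) - X (δ f (δ e Z)) * X Z
      eq = trans (solve 5 (λ u p q s t → (u :* u) :* (p :* q :- s :* t) :=
             (u :* p) :* (u :* q) :- (u :* s) :* (u :* t)) refl u _ _ _ _)
           (+-cong (*-cong (scale _) (scale _)) (-‿cong (*-cong (scale _) (scale _))))

    -- The terms carrying the indeterminate of `g` cancel in ΔZ{e,g}, so any positive value there
    -- will do; `1#` is taken.
    Δ-at-g : ∀ {e} → e ∈ A → ∀ {y} → (∀ i → i ∈ A → 0# < y i) →
      0# ≤ ev A (δ e Z) y * ev A (δ g Z) y - ev A (δ e (δ g Z)) y * ev A Z y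
    Δ-at-g {e} e∈A {y} 0<y = ≤-resp refl eq
      (Rayleigh.Δ≥0 rayleigh e g (A⊆E e∈A) g∈E (∈A⇒≢g e∈A) y₁ (update-pos 0<y 0<1))
      where
      y₁ = _[g↦_] 0<y 1#
      restrict : ∀ h → ev E (δ g h) y₁ ≈ ev A (δ g h) y
      restrict h = trans (ev-δ-peel g∈E h y₁)
        (ev-cong {E = A} (λ _ _ → refl) λ i → sym ∘ off-g 0<y 1# i)
      eq : Δ ℝ E Z e g y₁ ≈ ev A (δ e Z) y * ev A (δ g Z) y - ev A (δ e (δ g Z)) y * ev A Z y
      eq = trans (+-cong (*-cong (ev-update 0<y 1# (δ e Z)) (restrict Z))
                         (-‿cong (*-cong (restrict (δ e Z)) (ev-update 0<y 1# Z))))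
        (trans
          (solve 5 (λ o p p′ q q′ → (p :+ o :* p′) :* q′ :- p′ :* (q :+ o :* q′) := p :* q′ :- p′ :* q)
            refl 1# _ _ _ _)
          (+-congˡ (-‿cong (*-congʳ (ev-cong {E = A} (λ S _ → δ-comm g e Z S) λ _ _ → refl)))))

  module _ {k α β : Carrier} (0<k : 0# < k) (αβ≤1 : 0# ≤ 1# - α * β) where

    -- Treats the pairs whose first element is on the side of `P`. The remaining pairs follow by
    -- exchanging `P` with `Q`, or `e` with `f`.
    module Half {E F : Subset n} {g : Fin n} {P Q : Poly n}
      (sideP : Side α β E g P) (sideQ : Side α β F g Q)
      (dis : Disjoint (E ∖ g) (F ∖ g))
      {Z : Poly n} (Z≈ : ∀ S → S ⊆ (E ∖ g) ∪ (F ∖ g) →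
        Z S ≈ glue k α β (E ∖ g) (F ∖ g) P (δ g P) Q (δ g Q) S)
      {y : Fin n → Carrier} (0<y : ∀ i → i ∈ (E ∖ g) ∪ (F ∖ g) → 0# < y i) where

      A = E ∖ g
      B = F ∖ g
      N = A ∪ B
      P′ Q′ : Poly n
      P′ = δ g P
      Q′ = δ g Q
      module P = Side sideP
      module Q = Side sideQ

      0<yˡ : ∀ i → i ∈ A → 0# < y i
      0<yˡ i = 0<y i ∘ p⊆p∪q B

      0<yʳ : ∀ i → i ∈ B → 0# < y i
      0<yʳ i = 0<y i ∘ q⊆p∪q A B

      dis′ : Disjoint B A
      dis′ x∈B x∈A = dis x∈A x∈B

      inˡ : ∀ {e} → e ∈ A → e ∈ N
      inˡ = p⊆p∪q B

      inʳ : ∀ {e} → e ∈ B → e ∈ N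
      inʳ = q⊆p∪q A B

      q q′ : Carrier
      q = ev B Q y
      q′ = ev B Q′ y

      ev-as-glue : ∀ {h} (a a′ b b′ : Poly n) → (∀ S → S ⊆ N → h S ≈ glue k α β A B a a′ b b′ S) →
        ev N h y ≈ bilinear k α β (ev A a y) (ev A a′ y) (ev B b y) (ev B b′ y)
      ev-as-glue a a′ b b′ eq = trans (ev-cong {E = N} eq λ _ _ → refl) (ev-glue dis a a′ b b′ y)

      δˡ : ∀ {e h} (a a′ b b′ : Poly n) → e ∈ A → (∀ S → S ⊆ N → h S ≈ glue k α β A B a a′ b b′ S) →
        ∀ S → S ⊆ N → δ e h S ≈ glue k α β A B (δ e a) (δ e a′) b b′ S
      δˡ a a′ b b′ e∈A eq S S⊆N = trans (δ-cong (inˡ e∈A) eq S S⊆N) (δ-glue dis e∈A a a′ b b′ S)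

      δʳ : ∀ {f h} (a a′ b b′ : Poly n) → f ∈ B → (∀ S → S ⊆ N → h S ≈ glue k α β A B a a′ b b′ S) →
        ∀ S → S ⊆ N → δ f h S ≈ glue k α β A B a a′ (δ f b) (δ f b′) S
      δʳ a a′ b b′ f∈B eq S S⊆N = trans
        (δ-cong (inʳ f∈B) (λ T T⊆N → trans (eq T T⊆N) (glue-swap k α β A B a a′ b b′ T)) S S⊆N)
        (trans (δ-glue dis′ f∈B b b′ a a′ S) (glue-swap k α β B A (δ _ b) (δ _ b′) a a′ S))

      mixed : ∀ {e f} → e ∈ A → f ∈ B → 0# ≤ Δ ℝ N Z e f y
      mixed {e} {f} e∈A f∈B = ≤-resp refl (sym eq)
        (*-nonneg (<⇒≤ (*-pos 0<k 0<k)) (*-nonneg αβ≤1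
          (*-nonneg (P.Δ-at-g e∈A 0<yˡ) (Q.Δ-at-g f∈B 0<yʳ))))
        where
        eq = trans (+-cong
            (*-cong (ev-as-glue (δ e P) (δ e P′) Q Q′ (δˡ P P′ Q Q′ e∈A Z≈))
                    (ev-as-glue P P′ (δ f Q) (δ f Q′) (δʳ P P′ Q Q′ f∈B Z≈)))
            (-‿cong (*-cong (ev-as-glue (δ e P) (δ e P′) (δ f Q) (δ f Q′)
                              (δʳ (δ e P) (δ e P′) Q Q′ f∈B (δˡ P P′ Q Q′ e∈A Z≈)))
                            (ev-as-glue P P′ Q Q′ Z≈))))
          -- The two determinants produced here are ΔP{e,g} and ΔQ{f,g}, in the form without the
          -- indeterminate of `g` given by `Δ-at-g`.
          (bilinear-det k α β _ _ _ _ _ _ _ _)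

      same : ∀ {e f} → e ∈ A → f ∈ A → e ≢ f → 0# ≤ Δ ℝ N Z e f y
      same {e} {f} e∈A f∈A e≢f = ≤-resp refl (sym eq)
        (*-nonneg (<⇒≤ (*-pos 0<k 0<k))
          (P.Δ-combination e∈A f∈A e≢f 0<yˡ (Q.contract-pos 0<yʳ) (Q.delete-pos 0<yʳ)))
        where
        u = q′ - α * q
        w = q - β * q′
        X = λ h → u * ev A h y + w * ev A (δ g h) y
        -- Differentiating the glued polynomial turns `δ g P` into `δ e (δ g P)`, while `X` expects
        -- `δ g (δ e P)`; the last argument of `collect` absorbs this exchange.
        collect : ∀ {h} (a a′ : Poly n) → (∀ S → S ⊆ N → h S ≈ glue k α β A B a a′ Q Q′ S) →
          (∀ S → S ⊆ A → a′ S ≈ δ g a S) → ev N h y ≈ k * X a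
        collect a a′ eq a′≈ = trans (ev-as-glue a a′ Q Q′ eq)
          (trans (bilinear-collect k α β _ _ _ _) (*-congˡ (+-congˡ (*-congˡ
            (ev-cong {E = A} a′≈ λ _ _ → refl)))))
        eq : Δ ℝ N Z e f y ≈ (k * k) * (X (δ e P) * X (δ f P) - X (δ f (δ e P)) * X P)
        eq = trans (+-cong
            (*-cong (collect (δ e P) (δ e P′) (δˡ P P′ Q Q′ e∈A Z≈) (λ S _ → δ-comm e g P S))
                    (collect (δ f P) (δ f P′) (δˡ P P′ Q Q′ f∈A Z≈) (λ S _ → δ-comm f g P S)))
            (-‿cong (*-cong
              (collect (δ f (δ e P)) (δ f (δ e P′))
                (δˡ (δ e P) (δ e P′) Q Q′ f∈A (δˡ P P′ Q Q′ e∈A Z≈)) λ S S⊆A → trans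
                (δ-cong f∈A (λ T _ → δ-comm e g P T) S S⊆A) (δ-comm f g (δ e P) S))
              (collect P P′ Z≈ λ _ _ → refl))))
          (solve 5 (λ k s t v w → (k :* s) :* (k :* t) :- (k :* v) :* (k :* w) :=
            (k :* k) :* (s :* t :- v :* w)) refl k _ _ _ _)

    -- The ground set `N` is a variable with an equation, because that of the two-sum is a union of
    -- two such sets only up to a proved equality; matching on `≡.refl` avoids transporting `Z`.
    glue-Δ≥0 : {E F : Subset n} {g : Fin n} {P Q : Poly n} → Side α β E g P → Side α β F g Q →
      Disjoint (E ∖ g) (F ∖ g) → {N : Subset n} → N ≡ (E ∖ g) ∪ (F ∖ g) →
      {Z : Poly n} → (∀ S → S ⊆ N → Z S ≈ glue k α β (E ∖ g) (F ∖ g) P (δ g P) Q (δ g Q) S) →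
      ∀ e f → e ∈ N → f ∈ N → e ≢ f → ∀ y → (∀ i → i ∈ N → 0# < y i) → 0# ≤ Δ ℝ N Z e f y
    glue-Δ≥0 {E = E} {F} {g} {P} {Q} sideP sideQ dis ≡.refl {Z} Z≈ e f e∈N f∈N e≢f y 0<y
      with x∈p∪q⁻ (E ∖ g) (F ∖ g) e∈N | x∈p∪q⁻ (E ∖ g) (F ∖ g) f∈N
    ... | inj₁ e∈A | inj₁ f∈A = Half.same sideP sideQ dis Z≈ 0<y e∈A f∈A e≢f
    ... | inj₁ e∈A | inj₂ f∈B = Half.mixed sideP sideQ dis Z≈ 0<y e∈A f∈B
    ... | inj₂ e∈B | inj₁ f∈A = ≤-resp refl (Δ-comm ((E ∖ g) ∪ (F ∖ g)) Z f e y)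
      (Half.mixed sideP sideQ dis Z≈ 0<y f∈A e∈B)
    ... | inj₂ e∈B | inj₂ f∈B = ≡.subst (λ N → 0# ≤ Δ ℝ N Z e f y) (∪-comm (F ∖ g) (E ∖ g))
      (Half.same sideQ sideP (λ x∈B x∈A → dis x∈A x∈B)
        (λ S S⊆ → trans (Z≈ S (≡.subst (S ⊆_) (∪-comm (F ∖ g) (E ∖ g)) S⊆))
          (glue-swap k α β (E ∖ g) (F ∖ g) P (δ g P) Q (δ g Q) S))
        (λ i i∈ → 0<y i (≡.subst (i ∈_) (∪-comm (F ∖ g) (E ∖ g)) i∈)) e∈B f∈B e≢f)

  -- Indicator coefficients

  ⟦_⟧ : ∀ {p} {P : Set p} → Dec P → Carrier
  ⟦ P? ⟧ = if does P? then 1# else 0#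

  module _ {p q} {P : Set p} {Q : Set q} where

    ⟦⟧-⇔ : P ⇔ Q → (P? : Dec P) (Q? : Dec Q) → ⟦ P? ⟧ ≈ ⟦ Q? ⟧
    ⟦⟧-⇔ P⇔Q P? Q? = reflexive (≡.cong (if_then 1# else 0#) (does-⇔ P⇔Q P? Q?))

    ⟦⟧-× : (P? : Dec P) (Q? : Dec Q) → ⟦ P? ×-dec Q? ⟧ ≈ ⟦ P? ⟧ * ⟦ Q? ⟧
    ⟦⟧-× (yes _) Q? = sym (*-identityˡ _)
    ⟦⟧-× (no _)  Q? = sym (zeroˡ _)

    ⟦⟧-⊎ : (P? : Dec P) (Q? : Dec Q) → ⟦ P? ⊎-dec Q? ⟧ ≈ (⟦ P? ⟧ + ⟦ Q? ⟧) - ⟦ P? ×-dec Q? ⟧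
    ⟦⟧-⊎ (yes _) Q? = solve 2 (λ o x → o := (o :+ x) :- x) refl 1# _
    ⟦⟧-⊎ (no _)  Q? = sym (trans (x-0≈x _) (+-identityˡ _))

    ⟦⟧-difference : (Q → P) → (P? : Dec P) (Q? : Dec Q) → NonNegative (⟦ P? ⟧ - 1# * ⟦ Q? ⟧)
    ⟦⟧-difference Q⇒P (yes _) (yes _) =
      null (trans (+-congˡ (-‿cong (*-identityˡ 1#))) (-‿inverseʳ 1#))
    ⟦⟧-difference Q⇒P (no ¬p) (yes q) = contradiction (Q⇒P q) ¬p
    ⟦⟧-difference Q⇒P (yes _) (no _)  =
      pos (<-resp refl (trans (sym (x-0≈x 1#)) (+-congˡ (-‿cong (sym (zeroʳ 1#))))) 0<1)
    ⟦⟧-difference Q⇒P (no _)  (no _)  = null (trans (+-congˡ (-‿cong (zeroʳ 1#))) (x-0≈x 0#))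

    ⟦⟧-difference-pos : P → ¬ Q → (P? : Dec P) (Q? : Dec Q) → 0# < ⟦ P? ⟧ - 1# * ⟦ Q? ⟧
    ⟦⟧-difference-pos p ¬q (no ¬p) _      = contradiction p ¬p
    ⟦⟧-difference-pos p ¬q (yes _) (yes q) = contradiction q ¬q
    ⟦⟧-difference-pos p ¬q (yes _) (no _) =
      <-resp refl (trans (sym (x-0≈x 1#)) (+-congˡ (-‿cong (sym (zeroʳ 1#))))) 0<1

  x-0*z≈x : ∀ x z → x - 0# * z ≈ x
  x-0*z≈x x z = trans (+-congˡ (-‿cong (zeroˡ z))) (x-0≈x x)

  module _ {p} {P : Set p} where

    ⟦⟧-nonneg : (P? : Dec P) → NonNegative ⟦ P? ⟧
    ⟦⟧-nonneg (yes _) = pos 0<1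
    ⟦⟧-nonneg (no _)  = null refl

    ⟦⟧-pos : P → (P? : Dec P) → 0# < ⟦ P? ⟧
    ⟦⟧-pos p (yes _) = 0<1
    ⟦⟧-pos p (no ¬p) = contradiction p ¬p

    ⟦⟧-nonneg′ : (P? : Dec P) (z : Carrier) → NonNegative (⟦ P? ⟧ - 0# * z)
    ⟦⟧-nonneg′ P? z = NonNegative-resp (sym (x-0*z≈x _ z)) (⟦⟧-nonneg P?)

    ⟦⟧-pos′ : P → (P? : Dec P) (z : Carrier) → 0# < ⟦ P? ⟧ - 0# * z
    ⟦⟧-pos′ p P? z = <-resp refl (sym (x-0*z≈x _ z)) (⟦⟧-pos p P?)

  module _ {a b c d e f} {P : Set a} {P′ : Set b} {Q : Set c} {Q′ : Set d} {R : Set e} {T : Set f}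
    (P? : Dec P) (P′? : Dec P′) (Q? : Dec Q) (Q′? : Dec Q′) (R? : Dec R) (T? : Dec T) where

    -- Inclusion-exclusion with `T` as the overlap of the two alternatives: α and β say which
    -- product is its indicator, namely neither for bases, the second for independent sets and the
    -- first for spanning sets.
    ⟦⟧-bilinear : ∀ {α β} → R ⇔ ((P × Q′) ⊎ (P′ × Q)) → T ⇔ ((P × Q′) × (P′ × Q)) →
      ⟦ T? ⟧ ≈ α * (⟦ P? ⟧ * ⟦ Q? ⟧) + β * (⟦ P′? ⟧ * ⟦ Q′? ⟧) →
      ⟦ R? ⟧ ≈ bilinear 1# α β ⟦ P? ⟧ ⟦ P′? ⟧ ⟦ Q? ⟧ ⟦ Q′? ⟧
    ⟦⟧-bilinear R⇔ T⇔ T≈ = trans (⟦⟧-⇔ R⇔ R? (PQ′? ⊎-dec P′Q?)) (trans (⟦⟧-⊎ PQ′? P′Q?) (trans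
      (+-cong (+-cong (⟦⟧-× P? Q′?) (⟦⟧-× P′? Q?))
        (-‿cong (trans (sym (⟦⟧-⇔ T⇔ T? (PQ′? ×-dec P′Q?))) T≈)))
      (sym (*-identityˡ _))))
      where
      PQ′? = P? ×-dec Q′?
      P′Q? = P′? ×-dec Q?

  -- The positivity conditions for one matroid

  module Sides (M : Matroid n) {g : Fin n}
    (g∈E : g ∈ Matroid.E M) (¬loop : ¬ Matroid.Loop M g) (¬coloop : ¬ Matroid.Coloop M g) where
    open Matroid M
    open MatroidProperties M

    private
      A = E ∖ g

      A⊆E : A ⊆ E
      A⊆E = p─q⊆p E ⁅ g ⁆

      g∉ : ∀ {S} → S ⊆ A → g ∉ S
      g∉ = x∉∖⇒

      ∪g⊆E : ∀ {S} → S ⊆ A → S ∪ ⁅ g ⁆ ⊆ E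
      ∪g⊆E S⊆A = ∪⊆ (A⊆E ∘ S⊆A) (⁅⁆⊆ g∈E)

    -- Nothing is subtracted here, so all that matters is a basis through `g` and a basis avoiding
    -- `g`.
    side-B : B-Rayleigh ℝ M → Side 0# 0# E g (familyPoly ℝ basis?)
    side-B rayleigh = record
      { g∈E      = g∈E
      ; rayleigh = rayleigh
      ; contract = (λ S _ → ⟦⟧-nonneg′ (basis? (S ∪ ⁅ g ⁆)) _)
                 , let (S , S⊆A , basis) = basis-with g∈E ¬loop in
                   S , S⊆A , ⟦⟧-pos′ basis (basis? (S ∪ ⁅ g ⁆)) _
      ; delete   = (λ S _ → ⟦⟧-nonneg′ (basis? S) _)
                 , let (S , S⊆A , basis) = basis-without g∈E ¬coloop in
                   S , S⊆A , ⟦⟧-pos′ basis (basis? S) _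
      }

    -- The difference in `delete` marks the independent sets that become dependent with `g`; a basis
    -- avoiding `g` is one. For `contract` the empty set suffices, as `g` is not a loop.
    side-I : I-Rayleigh ℝ M → Side 0# 1# E g (familyPoly ℝ independent?)
    side-I rayleigh = record
      { g∈E      = g∈E
      ; rayleigh = rayleigh
      ; contract = (λ S _ → ⟦⟧-nonneg′ (independent? (S ∪ ⁅ g ⁆)) _)
                 , ⊥ , ⊥⊆ , ⟦⟧-pos′ (≡.subst Independent (≡.sym (∪-identityˡ ⁅ g ⁆))
                              (independent-⁅⁆ g∈E ¬loop))
                              (independent? (⊥ ∪ ⁅ g ⁆)) _
      ; delete   = (λ S S⊆A → ⟦⟧-difference (independent-⊆ (A⊆E ∘ S⊆A) (g∉ S⊆A))
                     (independent? S) (independent? (S ∪ ⁅ g ⁆)))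
                 , let (S , S⊆A , indep , span) = basis-without g∈E ¬coloop in
                   S , S⊆A , ⟦⟧-difference-pos indep (independent-spanning (g∉ S⊆A) span)
                     (independent? S) (independent? (S ∪ ⁅ g ⁆))
      }

    -- Dual to independent sets: the difference in `contract` marks the sets that span only with the
    -- help of `g`, such as a basis through `g` with `g` removed.
    side-S : S-Rayleigh ℝ M → Side 1# 0# E g (familyPoly ℝ spanning?)
    side-S rayleigh = record
      { g∈E      = g∈E
      ; rayleigh = rayleigh
      ; contract = (λ S S⊆A → ⟦⟧-difference (spanning-⊆ (p⊆p∪q ⁅ g ⁆) (∪g⊆E S⊆A))
                     (spanning? (S ∪ ⁅ g ⁆)) (spanning? S))
                 , let (S , S⊆A , indep , span) = basis-with g∈E ¬loop in
                   S , S⊆A , ⟦⟧-difference-pos span (λ s → independent-spanning (g∉ S⊆A) s indep)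
                     (spanning? (S ∪ ⁅ g ⁆)) (spanning? S)
      ; delete   = (λ S _ → ⟦⟧-nonneg′ (spanning? S) _)
                 , A , id , ⟦⟧-pos′ (spanning-∖ g∈E ¬coloop) (spanning? A) _
      }

    module _ {q} (0<q : 0# < q) (q<1 : q < 1#) where

      private
        t = q ⁻¹[ 0<q ]

        Z = pottsPoly ℝ M q 0<q

        Z-pos : ∀ S → 0# < Z S
        Z-pos S = ^-pos (rank S) (⁻¹-pos 0<q)

        closedᶜ : ∀ {S} → rank (S ∪ ⁅ g ⁆) ≡ rank S → Z (S ∪ ⁅ g ⁆) - 1# * Z S ≈ 0#
        closedᶜ {S} eq = trans
          (+-cong (reflexive (≡.cong (t ^_) eq)) (-‿cong (*-identityˡ _))) (-‿inverseʳ _)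

        0<t-1 : 0# < t - 1#
        0<t-1 = <-resp refl (trans (solve 3 (λ t o q → t :* (o :- q) := t :* o :- t :* q) refl t 1# q)
            (+-cong (*-identityʳ t) (-‿cong (⁻¹-inverseˡ 0<q))))
          (*-pos (⁻¹-pos 0<q) (x<y⇒0<y-x q<1))

        openᶜ : ∀ {S} → rank (S ∪ ⁅ g ⁆) ≡ suc (rank S) → 0# < Z (S ∪ ⁅ g ⁆) - 1# * Z S
        openᶜ {S} eq = <-resp refl
          (trans (solve 3 (λ t o z → (t :- o) :* z := t :* z :- o :* z) refl t 1# (Z S))
            (+-congʳ (reflexive (≡.cong (t ^_) (≡.sym eq)))))
          (*-pos 0<t-1 (Z-pos S))

        closedᵈ : ∀ {S} → rank (S ∪ ⁅ g ⁆) ≡ rank S → 0# < Z S - q * Z (S ∪ ⁅ g ⁆)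
        closedᵈ {S} eq = <-resp refl
          (trans (solve 3 (λ o q z → (o :- q) :* z := o :* z :- q :* z) refl 1# q (Z S))
            (+-cong (*-identityˡ _) (-‿cong (*-congˡ (reflexive (≡.cong (t ^_) (≡.sym eq)))))))
          (*-pos (x<y⇒0<y-x q<1) (Z-pos S))

        openᵈ : ∀ {S} → rank (S ∪ ⁅ g ⁆) ≡ suc (rank S) → Z S - q * Z (S ∪ ⁅ g ⁆) ≈ 0#
        openᵈ {S} eq = trans (+-congˡ (-‿cong (trans (*-congˡ (reflexive (≡.cong (t ^_) eq)))
            (trans (solve 3 (λ q t z → q :* (t :* z) := t :* q :* z) refl q t (Z S))
              (trans (*-congʳ (⁻¹-inverseˡ 0<q)) (*-identityˡ _))))))
          (-‿inverseʳ _)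

      -- Adjoining `g` multiplies a coefficient by 1 or by `t`, the inverse of `q`. Subtracting with
      -- α = 1 cancels the first case and with β = `q` the second; `q < 1#` makes what survives
      -- positive. The empty set is open at `g` and `A` is closed at `g`.
      side-Potts : Rayleigh ℝ E (pottsPoly ℝ M q 0<q) → Side 1# q E g (pottsPoly ℝ M q 0<q)
      side-Potts rayleigh = record
        { g∈E      = g∈E
        ; rayleigh = rayleigh
        ; contract = (λ S S⊆A → [ null ∘ closedᶜ , pos ∘ openᶜ ]′ (rank-∪⁅⁆ (A⊆E ∘ S⊆A) g∈E))
                   , ⊥ , ⊥⊆ , openᶜ (≡.trans (≡.cong rank (∪-identityˡ ⁅ g ⁆))
                       (≡.trans (proj₂ (independent-⁅⁆ g∈E ¬loop))
                         (≡.trans (∣⁅x⁆∣≡1 g) (≡.cong suc (≡.sym rank-⊥)))))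
        ; delete   = (λ S S⊆A → [ pos ∘ closedᵈ , null ∘ openᵈ ]′ (rank-∪⁅⁆ (A⊆E ∘ S⊆A) g∈E))
                   , A , id , closedᵈ (proj₂ (∈cl-∖ g∈E ¬coloop))
        }


  -- Closure of the four classes under two-sums

  module TwoSumClosure (L M : Matroid n) (g : Fin n) (h : TwoSummable L M g) where
    open TwoSumProperties L M g h
    open TwoSummable h

    private
      module SL = Sides L g∈Eˡ ¬loopˡ ¬coloopˡ
      module SM = Sides M g∈Eʳ ¬loopʳ ¬coloopʳ

    rayleigh-twoSum : ∀ {k α β} → 0# < k → 0# ≤ 1# - α * β → {P Q Z : Poly n} →
      Side α β L.E g P → Side α β M.E g Q →
      (∀ {S} → S ⊆ N.E → Z S ≈
        bilinear k α β (P (S ∩ A)) (P (S ∩ A ∪ ⁅ g ⁆)) (Q (S ∩ B)) (Q (S ∩ B ∪ ⁅ g ⁆))) →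
      (∀ S → NonNegative (Z S)) → ∃[ S ] (S ⊆ N.E × 0# < Z S) → Rayleigh ℝ N.E Z
    rayleigh-twoSum 0<k αβ≤1 {P} {Q} sideP sideQ Z≈ nn (S₀ , S₀⊆E , 0<Z) = record
      { nonneg  = λ S _ → NonNegative⇒≤ (nn S)
      ; nonzero = S₀ , S₀⊆E , >⇒# 0<Z
      ; Δ≥0     = glue-Δ≥0 0<k αβ≤1 sideP sideQ disjoint E≡ λ S S⊆E → trans (Z≈ S⊆E)
          (bilinear-cong refl (sym (δ-∉ P (g∉X S⊆E))) refl (sym (δ-∉ Q (g∉Y S⊆E))))
      }

    private
      1-0≥0 : ∀ {x} → x ≈ 0# → 0# ≤ 1# - x
      1-0≥0 x≈0 = <⇒≤ (<-resp refl (trans (sym (x-0≈x 1#)) (+-congˡ (-‿cong (sym x≈0)))) 0<1)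

    B-closed : B-Rayleigh ℝ L → B-Rayleigh ℝ M → B-Rayleigh ℝ (twoSum L M g h)
    B-closed l m = rayleigh-twoSum 0<1 (1-0≥0 (zeroˡ 0#)) (SL.side-B l) (SM.side-B m)
      (λ {S} S⊆E → ⟦⟧-bilinear (L.basis? (S ∩ A)) (L.basis? (S ∩ A ∪ ⁅ g ⁆))
         (M.basis? (S ∩ B)) (M.basis? (S ∩ B ∪ ⁅ g ⁆))
         -- The overlap is the empty type: it would make `S ∩ A` spanning and still independent
         -- after adjoining `g`.
         (N.basis? S) (no id)
         (mk⇔ ([ inj₂ , inj₁ ]′ ∘ Equivalence.to (basis⇔ S⊆E))
              (Equivalence.from (basis⇔ S⊆E) ∘ [ inj₂ , inj₁ ]′))
         (mk⇔ (λ ()) λ (((_ , s) , _) , ((i′ , _) , _)) → LP.independent-spanning (g∉X S⊆E) s i′)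
         (sym (trans (+-cong (zeroˡ _) (zeroˡ _)) (+-identityˡ 0#))))
      (λ S → ⟦⟧-nonneg (N.basis? S))
      (let (S , basis) = MatroidProperties.basis-exists (twoSum L M g h) in
       S , proj₁ (proj₁ basis) , ⟦⟧-pos basis (N.basis? S))

    I-closed : I-Rayleigh ℝ L → I-Rayleigh ℝ M → I-Rayleigh ℝ (twoSum L M g h)
    I-closed l m = rayleigh-twoSum 0<1 (1-0≥0 (zeroˡ 1#)) (SL.side-I l) (SM.side-I m)
      (λ {S} S⊆E → let
           i′⇒i = LP.independent-⊆ (X⊆E S⊆E) (g∉X S⊆E)
           j′⇒j = MP.independent-⊆ (Y⊆E S⊆E) (g∉Y S⊆E)
           i′? = L.independent? (S ∩ A ∪ ⁅ g ⁆)
           j′? = M.independent? (S ∩ B ∪ ⁅ g ⁆)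
         in ⟦⟧-bilinear (L.independent? (S ∩ A)) i′? (M.independent? (S ∩ B)) j′?
         (N.independent? S) (i′? ×-dec j′?)
         (mk⇔ ((λ { (i , j , inj₁ i′) → inj₂ (i′ , j) ; (i , j , inj₂ j′) → inj₁ (i , j′) })
                 ∘ Equivalence.to (independent⇔ S⊆E))
              (Equivalence.from (independent⇔ S⊆E)
                 ∘ λ { (inj₁ (i , j′)) → i , j′⇒j j′ , inj₂ j′
                      ; (inj₂ (i′ , j)) → i′⇒i i′ , j , inj₁ i′ }))
         (mk⇔ (λ (i′ , j′) → (i′⇒i i′ , j′) , (i′ , j′⇒j j′)) λ ((_ , j′) , (i′ , _)) → i′ , j′)
         (trans (⟦⟧-× i′? j′?) (sym (trans (+-cong (zeroˡ _) (*-identityˡ _)) (+-identityˡ _)))))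
      (λ S → ⟦⟧-nonneg (N.independent? S))
      (⊥ , ⊥⊆ , ⟦⟧-pos (MatroidProperties.independent-⊥ (twoSum L M g h)) (N.independent? ⊥))

    S-closed : S-Rayleigh ℝ L → S-Rayleigh ℝ M → S-Rayleigh ℝ (twoSum L M g h)
    S-closed l m = rayleigh-twoSum 0<1 (1-0≥0 (zeroʳ 1#)) (SL.side-S l) (SM.side-S m)
      (λ {S} S⊆E → let
           s⇒s′ = LP.spanning-⊆ (p⊆p∪q ⁅ g ⁆) (X∪g⊆E S⊆E)
           t⇒t′ = MP.spanning-⊆ (p⊆p∪q ⁅ g ⁆) (Y∪g⊆E S⊆E)
           s? = L.spanning? (S ∩ A)
           t? = M.spanning? (S ∩ B)
         in ⟦⟧-bilinear s? (L.spanning? (S ∩ A ∪ ⁅ g ⁆)) t? (M.spanning? (S ∩ B ∪ ⁅ g ⁆))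
         (N.spanning? S) (s? ×-dec t?)
         (mk⇔ ((λ { (s′ , t′ , inj₁ s) → inj₁ (s , t′) ; (s′ , t′ , inj₂ t) → inj₂ (s′ , t) })
                 ∘ Equivalence.to (spanning⇔ S⊆E))
              (Equivalence.from (spanning⇔ S⊆E)
                 ∘ λ { (inj₁ (s , t′)) → s⇒s′ s , t′ , inj₁ s
                      ; (inj₂ (s′ , t)) → s′ , t⇒t′ t , inj₂ t }))
         (mk⇔ (λ (s , t) → (s , t⇒t′ t) , (s⇒s′ s , t)) λ ((s , _) , (_ , t)) → s , t)
         (trans (⟦⟧-× s? t?) (sym (trans (+-cong (*-identityˡ _) (zeroˡ _)) (+-identityʳ _)))))
      (λ S → ⟦⟧-nonneg (N.spanning? S))
      (N.E , id , ⟦⟧-pos (MatroidProperties.spanning-E (twoSum L M g h)) (N.spanning? N.E))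

    module _ {q} (0<q : 0# < q) (q<1 : q < 1#) where

      private
        0<1-q = x<y⇒0<y-x q<1
        t s k : Carrier
        t = q ⁻¹[ 0<q ]
        s = (1# - q) ⁻¹[ 0<1-q ]
        k = q * s

        qt : ∀ x → q * (t * x) ≈ x
        qt x = trans (sym (*-assoc _ _ _))
          (trans (*-congʳ (trans (*-comm _ _) (⁻¹-inverseˡ 0<q))) (*-identityˡ x))

        unscale : ∀ x → s * (x - q * x) ≈ x
        unscale x = trans (*-congˡ (+-congʳ (sym (*-identityˡ x))))
          (trans (solve 4 (λ s o q x → s :* (o :* x :- q :* x) := s :* (o :- q) :* x) refl s 1# q x)
            (trans (*-congʳ (⁻¹-inverseˡ 0<1-q)) (*-identityˡ x)))

        -- With k = q/(1-q) and t = 1/q one has k(t-1) = 1.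
        k-unscale : ∀ x → k * (t * x - x) ≈ x
        k-unscale x = trans
          (solve 4 (λ q s tx x → q :* s :* (tx :- x) := s :* (q :* tx :- q :* x)) refl q s (t * x) x)
          (trans (*-congˡ (+-congʳ (qt x))) (unscale x))

        -- This and the next two are the equations that determine k, α and β. The extra factor `q`
        -- reflects the rank lost when `g` is closed on both sides.
        bilinear-cc : ∀ a b → bilinear k 1# q a a b b ≈ q * (a * b)
        bilinear-cc a b = trans
          (*-congˡ (trans (+-congˡ (-‿cong (+-congʳ (*-identityˡ _))))
            (solve 2 (λ x y → (x :+ x) :- (x :+ y) := x :- y) refl (a * b) (q * (a * b)))))
          (trans (*-assoc q s _) (*-congˡ (unscale _)))

        bilinear-oc : ∀ a b → bilinear k 1# q a (t * a) b b ≈ a * b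
        bilinear-oc a b = trans
          (*-congˡ (trans (+-cong (+-congˡ (*-assoc t a b))
                                  (-‿cong (+-cong (*-identityˡ _)
                                    (trans (*-congˡ (*-assoc t a b)) (qt _)))))
            (solve 2 (λ x y → (x :+ y) :- (x :+ x) := y :- x) refl (a * b) (t * (a * b)))))
          (k-unscale _)

        bilinear-oo : ∀ a b → bilinear k 1# q a (t * a) b (t * b) ≈ a * b
        bilinear-oo a b = trans
          (*-congˡ (trans (+-cong (+-cong (pull-t a b) (*-assoc t a b))
                                  (-‿cong (+-cong (*-identityˡ _)
                                    (trans (*-congˡ (*-assoc t a (t * b)))
                                           (trans (qt _) (pull-t a b))))))
            (solve 2 (λ x y → (y :+ y) :- (x :+ y) := y :- x) refl (a * b) (t * (a * b)))))
          (k-unscale _)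
          where
          pull-t : ∀ a b → a * (t * b) ≈ t * (a * b)
          pull-t = solve 3 (λ t a b → a :* (t :* b) := t :* (a :* b)) refl t

      potts-bilinear : ∀ {S} → S ⊆ N.E → let P = pottsPoly ℝ L q 0<q ; Q = pottsPoly ℝ M q 0<q in
        pottsPoly ℝ (twoSum L M g h) q 0<q S ≈
        bilinear k 1# q (P (S ∩ A)) (P (S ∩ A ∪ ⁅ g ⁆)) (Q (S ∩ B)) (Q (S ∩ B ∪ ⁅ g ⁆))
      potts-bilinear {S} S⊆E = go (rankCase S⊆E)
        where
        a = t ^ L.rank (S ∩ A)
        b = t ^ M.rank (S ∩ B)

        power : ∀ {i j} → i ≡ j → t ^ i ≈ t ^ j
        power eq = reflexive (≡.cong (t ^_) eq)

        product : ∀ {i} → i ≡ L.rank (S ∩ A) ℕ.+ M.rank (S ∩ B) → t ^ i ≈ a * b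
        product eq = trans (power eq) (^-homo-* t (L.rank (S ∩ A)) (M.rank (S ∩ B)))

        go : RankCase S⊆E → t ^ N.rank S ≈
          bilinear k 1# q a (t ^ L.rank (S ∩ A ∪ ⁅ g ⁆)) b (t ^ M.rank (S ∩ B ∪ ⁅ g ⁆))
        go (cc p p′ r) = trans (sym (qt _)) (trans (*-congˡ (product r)) (trans (sym (bilinear-cc a b))
          (bilinear-cong refl (power (≡.sym p)) refl (power (≡.sym p′)))))
        -- The form is symmetric in the two sides, so this case reduces to `bilinear-oc` with the
        -- sides exchanged.
        go (co p p′ r) = trans (product r) (trans (*-comm a b) (trans (sym (bilinear-oc b a))
          (trans (bilinear-swap k 1# q _ _ _ _)
            (bilinear-cong refl (power (≡.sym p)) refl (power (≡.sym p′))))))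
        go (oc p p′ r) = trans (product r) (trans (sym (bilinear-oc a b))
          (bilinear-cong refl (power (≡.sym p)) refl (power (≡.sym p′))))
        go (oo p p′ r) = trans (product r) (trans (sym (bilinear-oo a b))
          (bilinear-cong refl (power (≡.sym p)) refl (power (≡.sym p′))))

      potts-rayleigh : Rayleigh ℝ L.E (pottsPoly ℝ L q 0<q) → Rayleigh ℝ M.E (pottsPoly ℝ M q 0<q) →
        Rayleigh ℝ N.E (pottsPoly ℝ (twoSum L M g h) q 0<q)
      potts-rayleigh l m = rayleigh-twoSum (*-pos 0<q (⁻¹-pos 0<1-q))
        (<⇒≤ (<-resp refl (+-congˡ (-‿cong (sym (*-identityˡ q)))) 0<1-q))
        (SL.side-Potts 0<q q<1 l) (SM.side-Potts 0<q q<1 m) potts-bilinear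
        (λ S → pos (^-pos (N.rank S) (⁻¹-pos 0<q)))
        (⊥ , ⊥⊆ , ^-pos (N.rank ⊥) (⁻¹-pos 0<q))

    Potts-closed : Potts-Rayleigh ℝ L → Potts-Rayleigh ℝ M → Potts-Rayleigh ℝ (twoSum L M g h)
    Potts-closed (qˡ , 0<qˡ , l) (qᵐ , 0<qᵐ , m) =
      -- The threshold has to be below both given ones and also strictly below 1, so that 1 - q is
      -- positive and invertible; two applications of `lowerBound` achieve this without comparing
      -- `qˡ` and `qᵐ`.
      let (z , 0<z , z<qˡ , z<qᵐ) = lowerBound 0<qˡ 0<qᵐ
          (w , 0<w , w<z , w<1)   = lowerBound 0<z 0<1
      in w , 0<w , λ q 0<q q≤w → let
        below : ∀ {r} → z < r → q ≤ r
        below z<r r<q = q≤w (<-trans w<z (<-trans z<r r<q))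
      in potts-rayleigh 0<q (≤-<-trans q≤w w<1) (l q 0<q (below z<qˡ)) (m q 0<q (below z<qᵐ))

theorem5p8 : ∀ {c ℓ₁ ℓ₂ : Level} (ℝ : RealField c ℓ₁ ℓ₂) {n : ℕ} (L M : Matroid n) (g : Fin n)
    (h : TwoSummable L M g) →
    (B-Rayleigh ℝ L → B-Rayleigh ℝ M → B-Rayleigh ℝ (twoSum L M g h))
    × (I-Rayleigh ℝ L → I-Rayleigh ℝ M → I-Rayleigh ℝ (twoSum L M g h))
    × (S-Rayleigh ℝ L → S-Rayleigh ℝ M → S-Rayleigh ℝ (twoSum L M g h))
    × (Potts-Rayleigh ℝ L → Potts-Rayleigh ℝ M → Potts-Rayleigh ℝ (twoSum L M g h))
theorem5p8 ℝ L M g h = B-closed , I-closed , S-closed , Potts-closed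
  where open TwoSumClosure ℝ L M g h
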